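{- $f(m)=\Theta(m^2)$ as $m\to\infty$; that is, there exist constants $c,C>0$ and an integer $m_0$ such that $c\,m^2\leq f(m)\leq C\,m^2$ for all integers $m\geq m_0$.
   Context: Graphs are finite, simple and undirected. $\lambda(G)$ is the spectral radius of $G$, i.e. the largest eigenvalue of its adjacency matrix. $f(m)$ is the minimum number of copies of 4-cycles (not necessarily induced subgraphs isomorphic to $C_4$) over all (labelled) graphs $G$ with exactly $m$ edges and $\lambda(G)>\sqrt{m}$. -}

module Defs where

open import Data.Bool.Base using (if_then_else_)
open import Data.Fin.Base as Fin using (Fin)
import Data.Fin.Properties as Fin
open import Data.Integer.Base as ℤ using (+_; +[1+_])
import Data.Integer.Properties as ℤ
open import Data.List.Base using (List; length; filter; allFin; cartesianProduct)
open import Data.Nat.Base as ℕ using (ℕ; zero; suc; z≤n; s≤s)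
import Data.Nat.Properties as ℕ
open import Data.Nat.Solver using (module +-*-Solver)
open import Data.Product.Base using (Σ-syntax; ∃; ∃-syntax; _×_; _,_; proj₁; proj₂)
open import Data.Rational.Base
open import Data.Rational.Properties
import Data.Rational.Solver as ℚ-Solver
open import Data.Rational.Unnormalised.Base as ℚᵘ using (mkℚᵘ)
import Data.Rational.Unnormalised.Properties as ℚᵘ
open import Data.Sum.Base using (inj₁; inj₂)
open import Data.Vec.Functional using (Vector; foldr)
open import Level using (0ℓ)
open import Relation.Binary.Core using (Rel)
open import Relation.Binary.Definitions using (Decidable; Symmetric; Irreflexive)
open import Relation.Binary.PropositionalEquality
  using (_≡_; refl; trans; cong; cong₂; subst₂; module ≡-Reasoning)
  renaming (sym to ≡-sym)
open import Relation.Nullary using (¬_; Dec; yes; no; does; _×-dec_)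

------------------------------------------------------------------------
-- Real numbers, as Cauchy sequences of rationals

IsCauchy : (ℕ → ℚ) → Set
IsCauchy x = ∀ ε → 0ℚ < ε →
  ∃[ N ] ∀ i j → N ℕ.≤ i → N ℕ.≤ j → ∣ x i - x j ∣ ≤ ε

record ℝ : Set where
  constructor mkℝ
  field
    seq    : ℕ → ℚ
    cauchy : IsCauchy seq

open ℝ public

infix 4 _≈ᴿ_ _<ᴿ_ _≤ᴿ_

_≈ᴿ_ : Rel ℝ 0ℓ
x ≈ᴿ y = ∀ ε → 0ℚ < ε → ∃[ N ] ∀ n → N ℕ.≤ n → ∣ seq x n - seq y n ∣ ≤ ε

_<ᴿ_ : Rel ℝ 0ℓ
x <ᴿ y = ∃[ ε ] 0ℚ < ε × (∃[ N ] ∀ n → N ℕ.≤ n → seq x n + ε ≤ seq y n)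

_≤ᴿ_ : Rel ℝ 0ℓ
x ≤ᴿ y = ∀ ε → 0ℚ < ε → ∃[ N ] ∀ n → N ℕ.≤ n → seq x n ≤ seq y n + ε

fromℚ : ℚ → ℝ
fromℚ q = mkℝ (λ _ → q) λ ε 0<ε → 0 , λ _ _ _ _ →
  ≤-trans (≤-reflexive (cong ∣_∣ (+-inverseʳ q))) (<⇒≤ 0<ε)

fromℕ : ℕ → ℝ
fromℕ n = fromℚ (+ n / 1)

0ᴿ 1ᴿ : ℝ
0ᴿ = fromℕ 0
1ᴿ = fromℕ 1

private
  half-pos : ∀ ε → 0ℚ < ε → 0ℚ < ½ * ε
  half-pos ε 0<ε = positive⁻¹ (½ * ε)
    {{pos*pos⇒pos ½ ε {{positive 0<ε}}}}

  half+half : ∀ ε → ½ * ε + ½ * ε ≡ ε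
  half+half ε = trans (≡-sym (*-distribʳ-+ ε ½ ½)) (*-identityˡ ε)

  abstract
    +-cauchy : ∀ {x y} → IsCauchy x → IsCauchy y → IsCauchy (λ n → x n + y n)
    +-cauchy {x} {y} cx cy ε 0<ε
      with cx (½ * ε) (half-pos ε 0<ε) | cy (½ * ε) (half-pos ε 0<ε)
    ... | M , hM | N , hN = M ℕ.⊔ N , λ i j i≥ j≥ → begin
      ∣ (x i + y i) - (x j + y j) ∣     ≡⟨ cong ∣_∣ (rearrange (x i) (y i) (x j) (y j)) ⟩
      ∣ (x i - x j) + (y i - y j) ∣     ≤⟨ ∣p+q∣≤∣p∣+∣q∣ (x i - x j) (y i - y j) ⟩
      ∣ x i - x j ∣ + ∣ y i - y j ∣     ≤⟨ +-mono-≤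
         (hM i j (ℕ.m⊔n≤o⇒m≤o M N i≥) (ℕ.m⊔n≤o⇒m≤o M N j≥))
         (hN i j (ℕ.m⊔n≤o⇒n≤o M N i≥) (ℕ.m⊔n≤o⇒n≤o M N j≥)) ⟩
      ½ * ε + ½ * ε                     ≡⟨ half+half ε ⟩
      ε                                 ∎
      where
      open ≤-Reasoning
      open ℚ-Solver.+-*-Solver
      rearrange : ∀ a b c d → (a + b) - (c + d) ≡ (a - c) + (b - d)
      rearrange = solve 4 (λ a b c d →
        (a :+ b) :- (c :+ d) := (a :- c) :+ (b :- d)) refl

  eventuallyBounded : ∀ {x} → IsCauchy x →
    ∃[ B ] 0ℚ < B × (∃[ N ] ∀ n → N ℕ.≤ n → ∣ x n ∣ ≤ B)
  eventuallyBounded {x} cx with cx 1ℚ (positive⁻¹ 1ℚ)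
  ... | N , h = 1ℚ + ∣ x N ∣
              , <-≤-trans (positive⁻¹ 1ℚ)
                  (≤-trans (≤-reflexive (≡-sym (+-identityʳ 1ℚ)))
                           (+-monoʳ-≤ 1ℚ (0≤∣p∣ (x N))))
              , N , λ n n≥ → begin
    ∣ x n ∣                    ≡⟨ cong ∣_∣ (split (x n) (x N)) ⟩
    ∣ (x n - x N) + x N ∣      ≤⟨ ∣p+q∣≤∣p∣+∣q∣ (x n - x N) (x N) ⟩
    ∣ x n - x N ∣ + ∣ x N ∣    ≤⟨ +-monoˡ-≤ ∣ x N ∣ (h n N n≥ ℕ.≤-refl) ⟩
    1ℚ + ∣ x N ∣               ∎
    where
    open ≤-Reasoning
    open ℚ-Solver.+-*-Solver
    split : ∀ a b → a ≡ (a - b) + b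
    split = solve 2 (λ a b → a := (a :- b) :+ b) refl

  ∣*∣-mono : ∀ p q {a b} → ∣ p ∣ ≤ a → ∣ q ∣ ≤ b → ∣ p * q ∣ ≤ a * b
  ∣*∣-mono p q {a} {b} p≤a q≤b = begin
    ∣ p * q ∣       ≡⟨ ∣p*q∣≡∣p∣*∣q∣ p q ⟩
    ∣ p ∣ * ∣ q ∣   ≤⟨ *-monoʳ-≤-nonNeg ∣ q ∣ {{∣-∣-nonNeg q}} p≤a ⟩
    a * ∣ q ∣       ≤⟨ *-monoˡ-≤-nonNeg a {{nonNegative (≤-trans (0≤∣p∣ p) p≤a)}} q≤b ⟩
    a * b           ∎
    where open ≤-Reasoning

  *-difference : ∀ {A B δ} p q r s → ∣ p ∣ ≤ A → ∣ s ∣ ≤ B →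
    ∣ q - s ∣ ≤ δ → ∣ p - r ∣ ≤ δ → ∣ p * q - r * s ∣ ≤ (A + B) * δ
  *-difference {A} {B} {δ} p q r s p≤A s≤B qs≤δ pr≤δ = begin
    ∣ p * q - r * s ∣                    ≡⟨ cong ∣_∣ (rearrange p q r s) ⟩
    ∣ p * (q - s) + s * (p - r) ∣        ≤⟨ ∣p+q∣≤∣p∣+∣q∣ (p * (q - s)) (s * (p - r)) ⟩
    ∣ p * (q - s) ∣ + ∣ s * (p - r) ∣    ≤⟨ +-mono-≤ (∣*∣-mono p (q - s) p≤A qs≤δ)
                                                     (∣*∣-mono s (p - r) s≤B pr≤δ) ⟩
    A * δ + B * δ                        ≡⟨ *-distribʳ-+ δ A B ⟨
    (A + B) * δ                          ∎
    where
    open ≤-Reasoning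
    open ℚ-Solver.+-*-Solver
    rearrange : ∀ a b c d → a * b - c * d ≡ a * (b - d) + d * (a - c)
    rearrange = solve 4 (λ a b c d →
      a :* b :- c :* d := a :* (b :- d) :+ d :* (a :- c)) refl

  divide : ∀ K ε → 0ℚ < K → 0ℚ < ε → ∃[ δ ] 0ℚ < δ × K * δ ≡ ε
  divide K ε 0<K 0<ε = 1/ K * ε
    , positive⁻¹ (1/ K * ε) {{pos*pos⇒pos (1/ K) {{1/pos⇒pos K}} ε {{positive 0<ε}}}}
    , trans (≡-sym (*-assoc K (1/ K) ε))
        (trans (cong (_* ε) (*-inverseʳ K)) (*-identityˡ ε))
    where
    instance
      posK : Positive K
      posK = positive 0<K
      nzK : NonZero K
      nzK = pos⇒nonZero K

  abstract
    *-cauchy : ∀ {x y} → IsCauchy x → IsCauchy y → IsCauchy (λ n → x n * y n)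
    *-cauchy {x} {y} cx cy ε 0<ε =
      let A , 0<A , K , hA = eventuallyBounded {x} cx
          B , 0<B , L , hB = eventuallyBounded {y} cy
          δ , 0<δ , [A+B]δ≡ε = divide (A + B) ε (0<+ A B 0<A 0<B) 0<ε
          M , hM = cx δ 0<δ
          N , hN = cy δ 0<δ
      in (K ℕ.⊔ L) ℕ.⊔ (M ℕ.⊔ N) , λ i j i≥ j≥ →
      let i≥KL = ℕ.m⊔n≤o⇒m≤o (K ℕ.⊔ L) (M ℕ.⊔ N) i≥
          j≥KL = ℕ.m⊔n≤o⇒m≤o (K ℕ.⊔ L) (M ℕ.⊔ N) j≥
          i≥MN = ℕ.m⊔n≤o⇒n≤o (K ℕ.⊔ L) (M ℕ.⊔ N) i≥
          j≥MN = ℕ.m⊔n≤o⇒n≤o (K ℕ.⊔ L) (M ℕ.⊔ N) j≥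
      in ≤-trans
        (*-difference {A} {B} {δ} (x i) (y i) (x j) (y j)
          (hA i (ℕ.m⊔n≤o⇒m≤o K L i≥KL))
          (hB j (ℕ.m⊔n≤o⇒n≤o K L j≥KL))
          (hN i j (ℕ.m⊔n≤o⇒n≤o M N i≥MN) (ℕ.m⊔n≤o⇒n≤o M N j≥MN))
          (hM i j (ℕ.m⊔n≤o⇒m≤o M N i≥MN) (ℕ.m⊔n≤o⇒m≤o M N j≥MN)))
        (≤-reflexive [A+B]δ≡ε)
      where
      0<+ : ∀ a b → 0ℚ < a → 0ℚ < b → 0ℚ < a + b
      0<+ a b 0<a 0<b = <-trans 0<b (subst₂ _<_ (+-identityˡ b) refl (+-monoˡ-< b 0<a))

infixl 6 _+ᴿ_
infixl 7 _*ᴿ_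

_+ᴿ_ : ℝ → ℝ → ℝ
x +ᴿ y = mkℝ (λ n → seq x n + seq y n)
             (+-cauchy {seq x} {seq y} (cauchy x) (cauchy y))

_*ᴿ_ : ℝ → ℝ → ℝ
x *ᴿ y = mkℝ (λ n → seq x n * seq y n)
             (*-cauchy {seq x} {seq y} (cauchy x) (cauchy y))

Σᴿ : ∀ {n} → Vector ℝ n → ℝ
Σᴿ = foldr _+ᴿ_ 0ᴿ

------------------------------------------------------------------------
-- Square roots of natural numbers

isqrt : ℕ → ℕ
isqrt zero    = 0
isqrt (suc k) with suc (isqrt k) ℕ.* suc (isqrt k) ℕ.≤? suc k
... | yes _ = suc (isqrt k)
... | no  _ = isqrt k

isqrt-spec : ∀ k → isqrt k ℕ.* isqrt k ℕ.≤ k × k ℕ.< suc (isqrt k) ℕ.* suc (isqrt k)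
isqrt-spec zero = z≤n , s≤s z≤n
isqrt-spec (suc k)
  with suc (isqrt k) ℕ.* suc (isqrt k) ℕ.≤? suc k | isqrt-spec k
... | yes s≤k | lo , hi = s≤k , ℕ.≤-<-trans hi
  (ℕ.*-mono-< (ℕ.n<1+n (suc (isqrt k))) (ℕ.n<1+n (suc (isqrt k))))
... | no  s≰k | lo , hi = ℕ.m≤n⇒m≤1+n lo , ℕ.≰⇒> s≰k

-- ⌊ (i+1) √m ⌋ / (i+1), which is within 1/(i+1) of √m.
√-approx : ℕ → ℕ → ℚ
√-approx m i = + isqrt (m ℕ.* (suc i ℕ.* suc i)) / suc i

private
  /-mono-≤ : ∀ a b c d → a ℕ.* suc d ℕ.≤ c ℕ.* suc b → + a / suc b ≤ + c / suc d
  /-mono-≤ a b c d h = toℚᵘ-cancel-≤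
    (ℚᵘ.≤-trans (ℚᵘ.≤-reflexive (toℚᵘ-fromℚᵘ (mkℚᵘ (+ a) b)))
    (ℚᵘ.≤-trans (ℚᵘ.*≤* (subst₂ ℤ._≤_ (ℤ.pos-* a (suc d)) (ℤ.pos-* c (suc b)) (ℤ.+≤+ h)))
                (ℚᵘ.≤-reflexive (ℚᵘ.≃-sym (toℚᵘ-fromℚᵘ (mkℚᵘ (+ c) d))))))

  suc-/ : ∀ a b → + suc a / suc b ≡ + a / suc b + + 1 / suc b
  suc-/ a b = toℚᵘ-injective
    (ℚᵘ.≃-trans (toℚᵘ-fromℚᵘ (mkℚᵘ (+ suc a) b))
    (ℚᵘ.≃-trans (ℚᵘ.*≡* eq)
    (ℚᵘ.≃-sym (ℚᵘ.≃-trans (toℚᵘ-homo-+ (+ a / suc b) (+ 1 / suc b))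
      (ℚᵘ.+-cong (toℚᵘ-fromℚᵘ (mkℚᵘ (+ a) b)) (toℚᵘ-fromℚᵘ (mkℚᵘ (+ 1) b)))))))
    where
    open ≡-Reasoning
    s : ℕ
    s = suc b
    eqℕ : suc a ℕ.* (s ℕ.* s) ≡ (a ℕ.* s ℕ.+ 1 ℕ.* s) ℕ.* s
    eqℕ = solve 2 (λ x y → (con 1 :+ x) :* (y :* y)
                         := (x :* y :+ con 1 :* y) :* y) refl a s
      where open +-*-Solver
    eq : + suc a ℤ.* + (s ℕ.* s) ≡ (+ a ℤ.* + s ℤ.+ + 1 ℤ.* + s) ℤ.* + s
    eq = begin
      + suc a ℤ.* + (s ℕ.* s)                   ≡⟨ ℤ.pos-* (suc a) (s ℕ.* s) ⟨
      + (suc a ℕ.* (s ℕ.* s))                   ≡⟨ cong +_ eqℕ ⟩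
      + ((a ℕ.* s ℕ.+ 1 ℕ.* s) ℕ.* s)           ≡⟨ ℤ.pos-* (a ℕ.* s ℕ.+ 1 ℕ.* s) s ⟩
      + (a ℕ.* s ℕ.+ 1 ℕ.* s) ℤ.* + s           ≡⟨ cong (ℤ._* + s) (ℤ.pos-+ (a ℕ.* s) (1 ℕ.* s)) ⟩
      (+ (a ℕ.* s) ℤ.+ + (1 ℕ.* s)) ℤ.* + s     ≡⟨ cong (ℤ._* + s)
          (cong₂ ℤ._+_ (ℤ.pos-* a s) (ℤ.pos-* 1 s)) ⟩
      (+ a ℤ.* + s ℤ.+ + 1 ℤ.* + s) ℤ.* + s     ∎

  archimedean : ∀ ε → 0ℚ < ε → ∃[ N ] + 1 / suc N ≤ ε
  archimedean ε@(mkℚ +[1+ a ] d _) 0<ε = d ,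
    ≤-trans (/-mono-≤ 1 d (suc a) d (ℕ.*-monoˡ-≤ (suc d) (s≤s (z≤n {a}))))
            (≤-reflexive (fromℚᵘ-toℚᵘ ε))
  archimedean (mkℚ ℤ.-[1+ _ ] _ _) (*<* ())
  archimedean (mkℚ (+ 0) _ _) (*<* (ℤ.+<+ ()))

  sq-cancel-< : ∀ a b → a ℕ.* a ℕ.< b ℕ.* b → a ℕ.< b
  sq-cancel-< a b h with a ℕ.<? b
  ... | yes a<b = a<b
  ... | no  a≮b with () ← ℕ.<-irrefl refl
        (ℕ.<-≤-trans h (ℕ.*-mono-≤ (ℕ.≮⇒≥ a≮b) (ℕ.≮⇒≥ a≮b)))

  √-approx-close : ∀ m i j → √-approx m i ≤ √-approx m j + + 1 / suc j
  √-approx-close m i j = ≤-trans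
    (/-mono-≤ r i (suc s) j (ℕ.<⇒≤ (sq-cancel-< (r ℕ.* J) (suc s ℕ.* I) rJ²<)))
    (≤-reflexive (suc-/ s j))
    where
    I J r s : ℕ
    I = suc i
    J = suc j
    r = isqrt (m ℕ.* (I ℕ.* I))
    s = isqrt (m ℕ.* (J ℕ.* J))
    open ℕ.≤-Reasoning
    open +-*-Solver
    rJ²< : (r ℕ.* J) ℕ.* (r ℕ.* J) ℕ.< (suc s ℕ.* I) ℕ.* (suc s ℕ.* I)
    rJ²< = begin-strict
      (r ℕ.* J) ℕ.* (r ℕ.* J)
        ≡⟨ solve 2 (λ a b → (a :* b) :* (a :* b) := (a :* a) :* (b :* b)) refl r J ⟩
      (r ℕ.* r) ℕ.* (J ℕ.* J)
        ≤⟨ ℕ.*-monoˡ-≤ (J ℕ.* J) (proj₁ (isqrt-spec (m ℕ.* (I ℕ.* I)))) ⟩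
      (m ℕ.* (I ℕ.* I)) ℕ.* (J ℕ.* J)
        ≡⟨ solve 3 (λ a b c → (a :* b) :* c := (a :* c) :* b) refl m (I ℕ.* I) (J ℕ.* J) ⟩
      (m ℕ.* (J ℕ.* J)) ℕ.* (I ℕ.* I)
        <⟨ ℕ.*-monoˡ-< (I ℕ.* I) (proj₂ (isqrt-spec (m ℕ.* (J ℕ.* J)))) ⟩
      (suc s ℕ.* suc s) ℕ.* (I ℕ.* I)
        ≡⟨ solve 2 (λ a b → (a :* a) :* (b :* b) := (a :* b) :* (a :* b)) refl (suc s) I ⟩
      (suc s ℕ.* I) ℕ.* (suc s ℕ.* I) ∎

  ∣-∣-from-≤ : ∀ p q ε → p ≤ q + ε → q ≤ p + ε → ∣ p - q ∣ ≤ ε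
  ∣-∣-from-≤ p q ε p≤ q≤ with ∣p∣≡p∨∣p∣≡-p (p - q)
  ... | inj₁ eq = ≤-trans (≤-reflexive eq)
    (≤-trans (+-monoˡ-≤ (- q) p≤) (≤-reflexive (lem q ε)))
    where
    open ℚ-Solver.+-*-Solver
    lem : ∀ a b → (a + b) - a ≡ b
    lem = solve 2 (λ a b → (a :+ b) :- a := b) refl
  ... | inj₂ eq = ≤-trans (≤-reflexive (trans eq (flip p q)))
    (≤-trans (+-monoˡ-≤ (- p) q≤) (≤-reflexive (lem p ε)))
    where
    open ℚ-Solver.+-*-Solver
    flip : ∀ a b → - (a - b) ≡ b - a
    flip = solve 2 (λ a b → :- (a :- b) := b :- a) refl
    lem : ∀ a b → (a + b) - a ≡ b
    lem = solve 2 (λ a b → (a :+ b) :- a := b) refl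

  abstract
    √-cauchy : ∀ m → IsCauchy (√-approx m)
    √-cauchy m ε 0<ε with archimedean ε 0<ε
    ... | N , 1/N≤ε = N , λ i j i≥ j≥ →
      ∣-∣-from-≤ (√-approx m i) (√-approx m j) ε (close i j j≥) (close j i i≥)
      where
      close : ∀ i j → N ℕ.≤ j → √-approx m i ≤ √-approx m j + ε
      close i j j≥ = ≤-trans (√-approx-close m i j)
        (+-monoʳ-≤ (√-approx m j)
          (≤-trans (/-mono-≤ 1 j 1 N (ℕ.*-monoʳ-≤ 1 (s≤s j≥))) 1/N≤ε))

√_ : ℕ → ℝ
√ m = mkℝ (√-approx m) (√-cauchy m)

------------------------------------------------------------------------
-- Finite simple graphs on the vertex set Fin n

record Graph (n : ℕ) : Set₁ where
  field
    _~_    : Rel (Fin n) 0ℓ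
    _~?_   : Decidable _~_
    sym    : Symmetric _~_
    irrefl : Irreflexive _≡_ _~_

module _ {n : ℕ} (G : Graph n) where
  open Graph G using (_~_; _~?_)

  -- Each edge is listed once, as the pair (i , j) of its ends with i < j.
  edges : List (Fin n × Fin n)
  edges = filter (λ (i , j) → (i Fin.<? j) ×-dec (i ~? j))
                 (cartesianProduct (allFin n) (allFin n))

  #edges : ℕ
  #edges = length edges

  -- The subgraph with edges ab, bc, cd, da.  Of the eight tuples tracing a
  -- given 4-cycle, exactly one starts at its least vertex (a < b, a < c and,
  -- because b < d, also a < d) and runs in the direction with b < d.  The
  -- vertices are then distinct: b ≠ c ≠ d by irreflexivity of adjacency.
  IsC₄ : Fin n × Fin n × Fin n × Fin n → Set
  IsC₄ (a , b , c , d) =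
    (a Fin.< b × a Fin.< c × b Fin.< d) × (a ~ b × b ~ c × c ~ d × d ~ a)

  isC₄? : ∀ t → Dec (IsC₄ t)
  isC₄? (a , b , c , d) =
    ((a Fin.<? b) ×-dec (a Fin.<? c) ×-dec (b Fin.<? d)) ×-dec
    ((a ~? b) ×-dec (b ~? c) ×-dec (c ~? d) ×-dec (d ~? a))

  #C₄ : ℕ
  #C₄ = length (filter isC₄?
    (cartesianProduct (allFin n) (cartesianProduct (allFin n)
      (cartesianProduct (allFin n) (allFin n)))))

  adjacency : Fin n → Fin n → ℝ
  adjacency i j = if does (i ~? j) then 1ᴿ else 0ᴿ

module _ {n : ℕ} (A : Fin n → Fin n → ℝ) where

  IsEigenvalue : ℝ → Set
  IsEigenvalue μ = Σ[ v ∈ Vector ℝ n ]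
    ¬ (∀ i → v i ≈ᴿ 0ᴿ) ×
    (∀ i → Σᴿ (λ j → A i j *ᴿ v j) ≈ᴿ μ *ᴿ v i)

  IsLargestEigenvalue : ℝ → Set
  IsLargestEigenvalue μ = IsEigenvalue μ × (∀ ν → IsEigenvalue ν → ν ≤ᴿ μ)

IsSpectralRadius : ∀ {n} → Graph n → ℝ → Set
IsSpectralRadius G = IsLargestEigenvalue (adjacency G)

------------------------------------------------------------------------
-- The extremal function

-- The graphs over which the minimum f(m) is taken.
record Admissible (m : ℕ) {n : ℕ} (G : Graph n) : Set where
  field
    size     : #edges G ≡ m
    ρ        : ℝ
    isRadius : IsSpectralRadius G ρ
    ρ>√m     : √ m <ᴿ ρ

-- k = f(m).  This is a relation because f(m) is a minimum over a family that
-- is empty for some m (for instance m = 1).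
_isMinC₄For_ : ℕ → ℕ → Set₁
k isMinC₄For m =
  (∃[ n ] Σ[ G ∈ Graph n ] Admissible m G × #C₄ G ≡ k) ×
  (∀ {n} (G : Graph n) → Admissible m G → k ℕ.≤ #C₄ G)

module Submission where

-- Upper bound.  A 4-cycle is determined by one of its edges together with the
-- opposite edge and an orientation of the latter, so a graph with m edges has
-- at most 2m² of them (#C₄≤2m²).
--
-- Admissible graphs exist: write m = k(k+1)/2 + r with r ≤ k, and add r
-- disjoint edges to the complete graph on k + 1 vertices.  The spectral radius
-- is the maximal degree k, and k² > m for k ≥ 4 (admissible-exists).
--
-- Lower bound.  Let A be the adjacency matrix of a graph with m edges and
-- radius λ > √m, and take p and q with √m < p/q < (p+1)/q ≤ λ.  A rational
-- approximation to a real eigenvector, with signs dropped and denominators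
-- cleared, is a vector y of natural numbers for which Ay ≥ ((p+1)/q)y holds up
-- to an error that is tiny compared to some entry of y (eigenvalue⇒sub).  It is
-- obtained only up to double negation, which suffices because the desired
-- inequality between m² and the number of 4-cycles is decidable.  Everything
-- else is an argument about y in natural numbers.  Suppose that the number of
-- 4-cycles is a small multiple of m².
--
-- * Some vertex has degree at least 15m/16 (rayleigh-small).  Otherwise call a
--   vertex high if its degree exceeds m/4κ, for a large constant κ, and low if
--   not, and split yᵀAy into blocks.  There are at most 8κ high vertices, so
--   the high-high block contributes O(κ)|y|².  The other blocks are handled by
--   gram-bound.  If b is the high-low or low-low block of A, the diagonal of
--   the Gram matrix bᵀb is bounded by the degrees, while its off-diagonal part
--   has a squared Frobenius norm that counts closed walks of length four; these
--   are 4-cycles, which are few, and at most m²/2κ degenerate walks.  Hence the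
--   low-low block has norm at most ε√m, and the high-low block has squared
--   norm at most (15/16 + ε)m.  This makes yᵀAy smaller than √m|y|², contrary
--   to yᵀAy ≥ (p/q)|y|².
--
-- * No vertex u has degree at least 15m/16 (AlmostStar.no-maximum).  Few edges
--   avoid u, so two steps of Ay ≥ (p/q)y show that y is at most half of its
--   maximum away from u; thus the maximum is at u.  Two steps from u lead back
--   to u in deg u ways, and to other vertices in at most 2(m − deg u) ways,
--   each of weight at most half.  Up to the error this says that p²/q² is at
--   most deg u + (m − deg u) = m, a contradiction.

open import Defs
open import Data.Bool.Base using (true; false; if_then_else_)
open import Data.Empty using (⊥; ⊥-elim)
open import Data.Fin.Base as Fin using (Fin; zero; suc)
import Data.Fin.Properties as Fin
open import Data.Integer.Base as ℤ using (-[1+_]) renaming (+_ to pos)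
import Data.Integer.Properties as ℤ
open import Data.List.Base
  using (List; []; _∷_; _++_; length; filter; map; tabulate; allFin; cartesianProduct)
open import Data.List.Extrema.Nat using (argmax; f[xs]≤f[argmax])
open import Data.List.Membership.Propositional.Properties using (∈-allFin)
import Data.List.Properties as List
import Data.List.Relation.Unary.All as All
open import Data.Nat.Base
open import Data.Nat.Properties
open import Data.Nat.Tactic.RingSolver using (solve-∀)
open import Data.Product.Base using (Σ-syntax; _×_; _,_; ∃-syntax; proj₁; proj₂)
open import Data.Rational.Base as ℚ using (ℚ; mkℚ; 0ℚ; 1ℚ; ½; ∣_∣; toℚᵘ; *≤*; *<*)
  renaming (_+_ to _+ᵠ_; _*_ to _*ᵠ_; _-_ to _-ᵠ_; _≤_ to _≤ᵠ_; _<_ to _<ᵠ_)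
import Data.Rational.Properties as ℚ
import Data.Rational.Solver as ℚ-Solver
open import Data.Rational.Unnormalised.Base as ℚᵘ using (mkℚᵘ)
import Data.Rational.Unnormalised.Properties as ℚᵘ
open import Data.Sum.Base using (inj₁; inj₂)
open import Data.Unit.Base using (⊤; tt)
open import Data.Vec.Functional using (Vector)
open import Function.Base using (_∘_; _⟨_⟩_; case_of_; id)
open import Level using (0ℓ)
open import Relation.Binary.Definitions using (tri<; tri≈; tri>)
open import Relation.Binary.PropositionalEquality
open import Relation.Nullary using (yes; no; Dec; does; ¬_; contradiction; ¬?; _×-dec_)
open import Relation.Nullary.Decidable using (from-no; from-yes)
open import Relation.Unary using (Pred; Decidable)
import Algebra.Properties.Semiring.Sum +-*-semiring as Sum

private variable
  n k : ℕ

-- Inequalities between natural numbers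

sq-cancel-≤ : ∀ {a b} → a * a ≤ b * b → a ≤ b
sq-cancel-≤ {a} {b} h with a ≤? b
... | yes a≤b = a≤b
... | no  a≰b = contradiction (<-≤-trans (*-mono-< (≰⇒> a≰b) (≰⇒> a≰b)) h) (<-irrefl refl)

private
  2ab≤a²+b²′ : ∀ a d → 2 * (a * (a + d)) ≤ a * a + (a + d) * (a + d)
  2ab≤a²+b²′ a d = ≤-trans (m≤m+n _ (d * d)) (≤-reflexive (eq a d))
    where
    eq : ∀ a d → 2 * (a * (a + d)) + d * d ≡ a * a + (a + d) * (a + d)
    eq = solve-∀

2ab≤a²+b² : ∀ a b → 2 * (a * b) ≤ a * a + b * b
2ab≤a²+b² a b with ≤-total a b
... | inj₁ a≤b = subst (λ x → 2 * (a * x) ≤ a * a + x * x) (m+[n∸m]≡n a≤b) (2ab≤a²+b²′ a (b ∸ a))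
... | inj₂ b≤a = subst₂ _≤_ (cong (2 *_) (*-comm b a)) (+-comm (b * b) (a * a))
  (subst (λ x → 2 * (b * x) ≤ b * b + x * x) (m+[n∸m]≡n b≤a) (2ab≤a²+b²′ b (a ∸ b)))

4ab≤[a+b]² : ∀ a b → 4 * (a * b) ≤ (a + b) * (a + b)
4ab≤[a+b]² a b = begin
  4 * (a * b)                     ≡⟨ l a b ⟩
  2 * (a * b) + 2 * (a * b)       ≤⟨ +-monoʳ-≤ (2 * (a * b)) (2ab≤a²+b² a b) ⟩
  2 * (a * b) + (a * a + b * b)   ≡⟨ r a b ⟩
  (a + b) * (a + b)               ∎
  where
  open ≤-Reasoning
  l : ∀ a b → 4 * (a * b) ≡ 2 * (a * b) + 2 * (a * b)
  l = solve-∀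
  r : ∀ a b → 2 * (a * b) + (a * a + b * b) ≡ (a + b) * (a + b)
  r = solve-∀

-- Finite sums of natural numbers

infixr 6.5 ∑

-- Opacity lets the summand be inferred from the value of a sum.
opaque
  ∑ : (Fin n → ℕ) → ℕ
  ∑ = Sum.sum

syntax ∑ (λ i → x) = ∑[ i ] x

opaque
  unfolding ∑

  ∑-zero : (f : Fin 0 → ℕ) → ∑ f ≡ 0
  ∑-zero f = refl

  ∑-suc : (f : Fin (suc n) → ℕ) → ∑ f ≡ f zero + (∑[ i ] f (suc i))
  ∑-suc f = refl

  ∑-cong : {f g : Fin n → ℕ} → (∀ i → f i ≡ g i) → ∑ f ≡ ∑ g
  ∑-cong = Sum.sum-cong-≗

  ∑-+ : (f g : Fin n → ℕ) → (∑[ i ] (f i + g i)) ≡ ∑ f + ∑ g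
  ∑-+ = Sum.∑-distrib-+

  ∑-swap : (f : Fin n → Fin k → ℕ) → (∑[ i ] ∑[ j ] f i j) ≡ (∑[ j ] ∑[ i ] f i j)
  ∑-swap = Sum.∑-comm

  *-∑ : ∀ x (f : Fin n → ℕ) → x * ∑ f ≡ ∑[ i ] x * f i
  *-∑ = Sum.*-distribˡ-sum

  ∑-* : ∀ x (f : Fin n → ℕ) → ∑ f * x ≡ ∑[ i ] f i * x
  ∑-* = Sum.*-distribʳ-sum

  ∑-mono : {f g : Fin n → ℕ} → (∀ i → f i ≤ g i) → ∑ f ≤ ∑ g
  ∑-mono {zero}  f≤g = z≤n
  ∑-mono {suc n} f≤g = +-mono-≤ (f≤g zero) (∑-mono (f≤g ∘ suc))

  term≤∑ : (f : Fin n → ℕ) → ∀ i → f i ≤ ∑ f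
  term≤∑ f zero    = m≤m+n _ _
  term≤∑ f (suc i) = ≤-trans (term≤∑ (f ∘ suc) i) (m≤n+m _ (f zero))

  ∑-const : ∀ n k → ∑ {n} (λ _ → k) ≡ n * k
  ∑-const zero    k = refl
  ∑-const (suc n) k = cong (k +_) (∑-const n k)

∑*∑ : (f : Fin n → ℕ) (g : Fin k → ℕ) →
  ∑ f * ∑ g ≡ ∑[ i ] ∑[ j ] f i * g j
∑*∑ f g = trans (∑-* (∑ g) f)
  (∑-cong λ i → *-∑ (f i) g)

cauchy-schwarz : (f g : Fin n → ℕ) →
  (∑[ i ] f i * g i) * (∑[ i ] f i * g i) ≤
  (∑[ i ] f i * f i) * (∑[ i ] g i * g i)
cauchy-schwarz {n} f g = *-cancelˡ-≤ 2 (begin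
  2 * (fg * fg)
    ≡⟨ cong (2 *_) (∑*∑ _ _) ⟩
  2 * (∑[ i ] ∑[ j ] f i * g i * (f j * g j))
    ≡⟨ trans (*-∑ 2 (λ i → ∑[ j ] f i * g i * (f j * g j)))
         (∑-cong λ i → *-∑ 2 (λ j → f i * g i * (f j * g j))) ⟩
  ∑[ i ] ∑[ j ] 2 * (f i * g i * (f j * g j))
    ≤⟨ ∑-mono (λ i → ∑-mono (λ j → step (f i) (g i) (f j) (g j))) ⟩
  ∑[ i ] ∑[ j ] (f i * f i * (g j * g j) + f j * f j * (g i * g i))
    ≡⟨ ∑-cong (λ i → ∑-+ (λ j → f i * f i * (g j * g j)) (λ j → f j * f j * (g i * g i))) ⟩
  ∑[ i ] ((∑[ j ] f i * f i * (g j * g j)) + (∑[ j ] f j * f j * (g i * g i)))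
    ≡⟨ ∑-+ (λ i → ∑[ j ] f i * f i * (g j * g j)) (λ i → ∑[ j ] f j * f j * (g i * g i)) ⟩
  (∑[ i ] ∑[ j ] f i * f i * (g j * g j)) + (∑[ i ] ∑[ j ] f j * f j * (g i * g i))
    ≡⟨ cong₂ _+_ (sym (∑*∑ _ _)) (trans (∑-swap (λ i j → f j * f j * (g i * g i))) (sym (∑*∑ _ _))) ⟩
  ff * gg + ff * gg
    ≡⟨ cong (ff * gg +_) (sym (+-identityʳ _)) ⟩
  2 * (ff * gg) ∎)
  where
  open ≤-Reasoning
  fg ff gg : ℕ
  fg = ∑[ i ] f i * g i
  ff = ∑[ i ] f i * f i
  gg = ∑[ i ] g i * g i
  l : ∀ a b c d → 2 * (a * b * (c * d)) ≡ 2 * ((a * d) * (c * b))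
  l = solve-∀
  r : ∀ a b c d → (a * d) * (a * d) + (c * b) * (c * b) ≡ a * a * (d * d) + c * c * (b * b)
  r = solve-∀
  step : ∀ a b c d → 2 * (a * b * (c * d)) ≤ a * a * (d * d) + c * c * (b * b)
  step a b c d = ≤-trans (≤-reflexive (l a b c d))
    (≤-trans (2ab≤a²+b² (a * d) (c * b)) (≤-reflexive (r a b c d)))

-- The square of a quadratic form is bounded by the Frobenius norm of its matrix.
frobenius : (M : Fin n → Fin n → ℕ) (y : Fin n → ℕ) →
  let Q = ∑[ i ] y i * (∑[ j ] M i j * y j)
      s = ∑[ i ] y i * y i
  in Q * Q ≤ s * s * (∑[ i ] ∑[ j ] M i j * M i j)
frobenius {n} M y = begin
  Q * Q
    ≤⟨ cauchy-schwarz y (λ i → ∑[ j ] M i j * y j) ⟩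
  s * (∑[ i ] (∑[ j ] M i j * y j) * (∑[ j ] M i j * y j))
    ≤⟨ *-monoʳ-≤ s (∑-mono λ i → cauchy-schwarz (M i) y) ⟩
  s * (∑[ i ] (∑[ j ] M i j * M i j) * s)
    ≡⟨ cong (s *_) (sym (∑-* s (λ i → ∑[ j ] M i j * M i j))) ⟩
  s * (N * s)
    ≡⟨ eq s N ⟩
  s * s * N ∎
  where
  open ≤-Reasoning
  Q s N : ℕ
  Q = ∑[ i ] y i * (∑[ j ] M i j * y j)
  s = ∑[ i ] y i * y i
  N = ∑[ i ] ∑[ j ] M i j * M i j
  eq : ∀ s N → s * (N * s) ≡ s * s * N
  eq = solve-∀

-- Indicators and counting

-- The 0-1 indicator of a decidable proposition.
𝟙 : {P : Set} → Dec P → ℕ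
𝟙 p = if does p then 1 else 0

𝟙-× : {P Q : Set} (p : Dec P) (q : Dec Q) → 𝟙 (p ×-dec q) ≡ 𝟙 p * 𝟙 q
𝟙-× (yes _) (yes _) = refl
𝟙-× (yes _) (no  _) = refl
𝟙-× (no  _) _       = refl

𝟙-idem : {P : Set} (p : Dec P) → 𝟙 p * 𝟙 p ≡ 𝟙 p
𝟙-idem (yes _) = refl
𝟙-idem (no  _) = refl

𝟙≤1 : {P : Set} (p : Dec P) → 𝟙 p ≤ 1
𝟙≤1 (yes _) = ≤-refl
𝟙≤1 (no  _) = z≤n

𝟙-yes : {P : Set} (p : Dec P) → P → 𝟙 p ≡ 1
𝟙-yes (yes _) _ = refl
𝟙-yes (no ¬x) x = contradiction x ¬x

𝟙-no : {P : Set} (p : Dec P) → ¬ P → 𝟙 p ≡ 0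
𝟙-no (yes x) ¬x = contradiction x ¬x
𝟙-no (no _)  _  = refl

module _ {A : Set} {P : Pred A 0ℓ} (P? : Decidable P) where

  -- The number of entries of a list that satisfy P.
  count : List A → ℕ
  count xs = length (filter P? xs)

  count-∷ : ∀ x xs → count (x ∷ xs) ≡ 𝟙 (P? x) + count xs
  count-∷ x xs with does (P? x)
  ... | true  = refl
  ... | false = refl

  count-++ : ∀ xs ys → count (xs ++ ys) ≡ count xs + count ys
  count-++ xs ys = trans (cong length (List.filter-++ P? xs ys)) (List.length-++ (filter P? xs))

  count-tabulate : (f : Fin n → A) → count (tabulate f) ≡ ∑[ i ] 𝟙 (P? (f i))
  count-tabulate {zero}  f = sym (∑-zero _)
  count-tabulate {suc n} f = trans (count-∷ _ _)
    (trans (cong (𝟙 (P? (f zero)) +_) (count-tabulate (f ∘ suc))) (sym (∑-suc _)))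

module _ {A B : Set} {P : Pred B 0ℓ} (P? : Decidable P) (f : A → B) where

  count-map : ∀ xs → count P? (map f xs) ≡ count (λ x → P? (f x)) xs
  count-map []       = refl
  count-map (x ∷ xs) = trans (count-∷ P? (f x) (map f xs))
    (trans (cong (𝟙 (P? (f x)) +_) (count-map xs)) (sym (count-∷ (λ y → P? (f y)) x xs)))

count-cartesianProduct : {A B : Set} {P : Pred (A × B) 0ℓ} (P? : Decidable P)
  (f : Fin n → A) (ys : List B) →
  count P? (cartesianProduct (tabulate f) ys) ≡ ∑[ i ] count (λ y → P? (f i , y)) ys
count-cartesianProduct {zero}  P? f ys = sym (∑-zero _)
count-cartesianProduct {suc n} P? f ys = trans
  (count-++ P? (map (f zero ,_) ys) (cartesianProduct (tabulate (f ∘ suc)) ys))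
  (trans (cong₂ _+_ (count-map P? (f zero ,_) ys) (count-cartesianProduct P? (f ∘ suc) ys))
         (sym (∑-suc _)))

-- Fourfold sums

module _ {n : ℕ} where

  ∑⁴ : (Fin n → Fin n → Fin n → Fin n → ℕ) → ℕ
  ∑⁴ g = ∑[ a ] ∑[ b ] ∑[ c ] ∑[ d ] g a b c d

  ∑⁴-cong : ∀ {g h} → (∀ a b c d → g a b c d ≡ h a b c d) → ∑⁴ g ≡ ∑⁴ h
  ∑⁴-cong e = ∑-cong λ a → ∑-cong λ b → ∑-cong λ c → ∑-cong λ d → e a b c d

  ∑⁴-mono : ∀ {g h} → (∀ a b c d → g a b c d ≤ h a b c d) → ∑⁴ g ≤ ∑⁴ h
  ∑⁴-mono e = ∑-mono λ a → ∑-mono λ b → ∑-mono λ c → ∑-mono λ d → e a b c d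

  ∑⁴-+ : ∀ g h → ∑⁴ (λ a b c d → g a b c d + h a b c d) ≡ ∑⁴ g + ∑⁴ h
  ∑⁴-+ g h = trans (∑-cong λ a → trans (∑-cong λ b → trans (∑-cong λ c → ∑-+ _ _) (∑-+ _ _)) (∑-+ _ _)) (∑-+ _ _)

  private
    swap₁₂ : ∀ g → ∑⁴ (λ a b c d → g b a c d) ≡ ∑⁴ g
    swap₁₂ g = ∑-swap _

    swap₂₃ : ∀ g → ∑⁴ (λ a b c d → g a c b d) ≡ ∑⁴ g
    swap₂₃ g = ∑-cong λ a → ∑-swap _

    swap₃₄ : ∀ g → ∑⁴ (λ a b c d → g a b d c) ≡ ∑⁴ g
    swap₃₄ g = ∑-cong λ a → ∑-cong λ b → ∑-swap _

  ∑⁴-swap₁₃ : ∀ g → ∑⁴ (λ a b c d → g c b a d) ≡ ∑⁴ g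
  ∑⁴-swap₁₃ g = trans (swap₁₂ (λ a b c d → g c a b d))
    (trans (swap₂₃ (λ a b c d → g b a c d)) (swap₁₂ g))

  ∑⁴-swap₂₄ : ∀ g → ∑⁴ (λ a b c d → g a d c b) ≡ ∑⁴ g
  ∑⁴-swap₂₄ g = trans (swap₃₄ (λ a b c d → g a c d b))
    (trans (swap₂₃ (λ a b c d → g a b d c)) (swap₃₄ g))

  ∑⁴-swap₁₂,₃₄ : ∀ g → ∑⁴ (λ a b c d → g b a d c) ≡ ∑⁴ g
  ∑⁴-swap₁₂,₃₄ g = trans (swap₁₂ (λ a b c d → g a b d c)) (swap₃₄ g)

-- Order and equality indicators

-- Indicators of i ≡ j, i < j and i ≢ j.
eq lt ne : Fin n → Fin n → ℕ
eq i j = 𝟙 (i Fin.≟ j)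
lt i j = 𝟙 (i Fin.<? j)
ne i j = lt i j + lt j i

lt-irrefl : (i : Fin n) → lt i i ≡ 0
lt-irrefl i = 𝟙-no (i Fin.<? i) (<-irrefl refl)

ne-irrefl : (i : Fin n) → ne i i ≡ 0
ne-irrefl i = cong₂ _+_ (lt-irrefl i) (lt-irrefl i)

eq+ne : (i j : Fin n) → eq i j + ne i j ≡ 1
eq+ne i j with Fin.<-cmp i j
... | tri< i<j i≢j j≮i = cong₂ _+_ (𝟙-no (i Fin.≟ j) i≢j)
  (cong₂ _+_ (𝟙-yes (i Fin.<? j) i<j) (𝟙-no (j Fin.<? i) j≮i))
... | tri≈ i≮j i≡j j≮i = cong₂ _+_ (𝟙-yes (i Fin.≟ j) i≡j)
  (cong₂ _+_ (𝟙-no (i Fin.<? j) i≮j) (𝟙-no (j Fin.<? i) j≮i))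
... | tri> i≮j i≢j j<i = cong₂ _+_ (𝟙-no (i Fin.≟ j) i≢j)
  (cong₂ _+_ (𝟙-no (i Fin.<? j) i≮j) (𝟙-yes (j Fin.<? i) j<i))

≢⇒ne≡1 : {i j : Fin n} → i ≢ j → ne i j ≡ 1
≢⇒ne≡1 {i = i} {j} i≢j = trans (cong (_+ ne i j) (sym (𝟙-no (i Fin.≟ j) i≢j))) (eq+ne i j)

-- Summation against the diagonal.
∑-eq : (f : Fin n → ℕ) (i : Fin n) → (∑[ j ] eq i j * f j) ≡ f i
∑-eq {suc n} f zero = trans (∑-suc _) (trans
  (cong₂ _+_ (*-identityˡ (f zero)) (trans (∑-const n 0) (*-zeroʳ n))) (+-identityʳ _))
∑-eq {suc n} f (suc i) = trans (∑-suc _) (trans (∑-cong λ j → cong (_* f (suc j)) (eq-suc j)) (∑-eq (f ∘ suc) i))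
  where
  eq-suc : ∀ j → eq (suc i) (suc j) ≡ eq i j
  eq-suc j with i Fin.≟ j
  ... | yes _ = refl
  ... | no  _ = refl

-- A sum splits into the term at i and the terms away from i.
∑-split : (f : Fin n → ℕ) (i : Fin n) → ∑ f ≡ f i + (∑[ j ] ne i j * f j)
∑-split f i = trans (∑-cong λ j → trans (sym (*-identityˡ (f j)))
    (trans (cong (_* f j) (sym (eq+ne i j))) (*-distribʳ-+ (f j) (eq i j) (ne i j))))
  (trans (∑-+ _ _) (cong (_+ (∑[ j ] ne i j * f j)) (∑-eq f i)))

-- Counting edges and 4-cycles with the adjacency matrix

module Adjacency {n : ℕ} (G : Graph n) where
  open Graph G using (_~_; _~?_; irrefl) renaming (sym to ~-sym)

  -- The adjacency matrix and the degrees, as natural numbers.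
  adj : Fin n → Fin n → ℕ
  adj i j = 𝟙 (i ~? j)

  deg : Fin n → ℕ
  deg i = ∑[ j ] adj i j

  adj-sym : ∀ i j → adj i j ≡ adj j i
  adj-sym i j with j ~? i
  ... | yes j~i = 𝟙-yes (i ~? j) (~-sym j~i)
  ... | no  j≁i = 𝟙-no (i ~? j) (λ i~j → j≁i (~-sym i~j))

  adj-irrefl : ∀ i → adj i i ≡ 0
  adj-irrefl i = 𝟙-no (i ~? i) (irrefl refl)

  adj≤1 : ∀ i j → adj i j ≤ 1
  adj≤1 i j = 𝟙≤1 (i ~? j)

  ne*adj : ∀ i j → ne i j * adj i j ≡ adj i j
  ne*adj i j with i Fin.≟ j
  ... | yes refl = trans (cong (ne i i *_) (adj-irrefl i)) (trans (*-zeroʳ (ne i i)) (sym (adj-irrefl i)))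
  ... | no  i≢j  = trans (cong (_* adj i j) (≢⇒ne≡1 i≢j)) (*-identityˡ _)

  #edges≡∑ : #edges G ≡ ∑[ i ] ∑[ j ] lt i j * adj i j
  #edges≡∑ = trans (count-cartesianProduct P? id (allFin n))
    (∑-cong λ i → trans (count-tabulate (λ j → P? (i , j)) id)
      (∑-cong λ j → 𝟙-× (i Fin.<? j) (i ~? j)))
    where
    P? : (t : Fin n × Fin n) → Dec _
    P? (i , j) = (i Fin.<? j) ×-dec (i ~? j)

  handshake : ∑ deg ≡ 2 * #edges G
  handshake = begin
    (∑[ i ] ∑[ j ] adj i j)
      ≡⟨ ∑-cong (λ i → ∑-cong λ j → trans (sym (ne*adj i j)) (*-distribʳ-+ (adj i j) (lt i j) (lt j i))) ⟩
    (∑[ i ] ∑[ j ] (lt i j * adj i j + lt j i * adj i j))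
      ≡⟨ trans (∑-cong λ i → ∑-+ _ _) (∑-+ _ _) ⟩
    E + (∑[ i ] ∑[ j ] lt j i * adj i j)
      ≡⟨ cong (E +_) (trans (∑-swap _) (∑-cong λ i → ∑-cong λ j → cong (lt i j *_) (adj-sym j i))) ⟩
    E + E
      ≡⟨ cong (E +_) (sym (+-identityʳ E)) ⟩
    2 * E
      ≡⟨ cong (2 *_) (sym #edges≡∑) ⟩
    2 * #edges G ∎
    where
    open ≡-Reasoning
    E : ℕ
    E = ∑[ i ] ∑[ j ] lt i j * adj i j

  -- The indicator of a closed walk of length four.
  □ : Fin n → Fin n → Fin n → Fin n → ℕ
  □ a b c d = adj a b * (adj b c * (adj c d * adj d a))

  #C₄≡∑ : #C₄ G ≡ ∑⁴ (λ a b c d → lt a b * (lt a c * lt b d) * □ a b c d)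
  #C₄≡∑ = trans (count-cartesianProduct C? id _)
    (∑-cong λ a → trans (count-cartesianProduct (λ t → C? (a , t)) id _)
    (∑-cong λ b → trans (count-cartesianProduct (λ t → C? (a , b , t)) id _)
    (∑-cong λ c → trans (count-tabulate (λ d → C? (a , b , c , d)) id)
    (∑-cong λ d → indicator a b c d))))
    where
    C? = isC₄? G
    indicator : ∀ a b c d → 𝟙 (C? (a , b , c , d)) ≡ lt a b * (lt a c * lt b d) * □ a b c d
    indicator a b c d = trans (𝟙-× (a<b ×-dec a<c ×-dec b<d) (ab ×-dec bc ×-dec cd ×-dec da))
      (cong₂ _*_
        (trans (𝟙-× a<b (a<c ×-dec b<d)) (cong (lt a b *_) (𝟙-× a<c b<d)))
        (trans (𝟙-× ab (bc ×-dec cd ×-dec da)) (cong (adj a b *_)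
          (trans (𝟙-× bc (cd ×-dec da)) (cong (adj b c *_) (𝟙-× cd da))))))
      where
      a<b = a Fin.<? b
      a<c = a Fin.<? c
      b<d = b Fin.<? d
      ab = a ~? b
      bc = b ~? c
      cd = c ~? d
      da = d ~? a

  private
    □-swap₁₃ : ∀ a b c d → □ c b a d ≡ □ a b c d
    □-swap₁₃ a b c d = trans
      (cong₂ _*_ (adj-sym c b) (cong₂ _*_ (adj-sym b a) (cong₂ _*_ (adj-sym a d) (adj-sym d c))))
      (e (adj a b) (adj b c) (adj c d) (adj d a))
      where
      e : ∀ x y z w → y * (x * (w * z)) ≡ x * (y * (z * w))
      e = solve-∀

    □-swap₂₄ : ∀ a b c d → □ a d c b ≡ □ a b c d
    □-swap₂₄ a b c d = trans
      (cong₂ _*_ (adj-sym a d) (cong₂ _*_ (adj-sym d c) (cong₂ _*_ (adj-sym c b) (adj-sym b a))))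
      (e (adj a b) (adj b c) (adj c d) (adj d a))
      where
      e : ∀ x y z w → w * (z * (y * x)) ≡ x * (y * (z * w))
      e = solve-∀

    □-swap₁₂,₃₄ : ∀ a b c d → □ b a d c ≡ □ a b c d
    □-swap₁₂,₃₄ a b c d = trans
      (cong₂ _*_ (adj-sym b a) (cong₂ _*_ (adj-sym a d) (cong₂ _*_ (adj-sym d c) (adj-sym c b))))
      (e (adj a b) (adj b c) (adj c d) (adj d a))
      where
      e : ∀ x y z w → x * (w * (z * y)) ≡ x * (y * (z * w))
      e = solve-∀

    -- Closed walks a b c d with a < c and b < d (K), and those among them that
    -- start at their least vertex, which are the 4-cycles (H).
    K H : Fin n → Fin n → Fin n → Fin n → ℕ
    K a b c d = lt a c * lt b d * □ a b c d
    H a b c d = lt a b * (lt a c * lt b d) * □ a b c d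

    ∑K≡2∑H : ∑⁴ K ≡ ∑⁴ H + ∑⁴ H
    ∑K≡2∑H = trans (∑⁴-cong split) (trans (∑⁴-+ _ _) (cong (∑⁴ H +_) (∑⁴-swap₁₂,₃₄ H)))
      where
      e₁ : ∀ u v s x r → u * v * ((s * x) * r) ≡ u * v * (s * (x * r))
      e₁ = solve-∀
      e₂ : ∀ u v x y r → u * v * ((x + y) * r) ≡ x * (u * v) * r + y * (v * u) * r
      e₂ = solve-∀
      split : ∀ a b c d → K a b c d ≡ H a b c d + H b a d c
      split a b c d = begin
        lt a c * lt b d * □ a b c d
          ≡⟨ cong (λ x → lt a c * lt b d * (x * (adj b c * (adj c d * adj d a)))) (sym (ne*adj a b)) ⟩
        lt a c * lt b d * (ne a b * adj a b * (adj b c * (adj c d * adj d a)))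
          ≡⟨ e₁ (lt a c) (lt b d) (ne a b) (adj a b) (adj b c * (adj c d * adj d a)) ⟩
        lt a c * lt b d * (ne a b * □ a b c d)
          ≡⟨ e₂ (lt a c) (lt b d) (lt a b) (lt b a) (□ a b c d) ⟩
        H a b c d + lt b a * (lt b d * lt a c) * □ a b c d
          ≡⟨ cong (λ x → H a b c d + lt b a * (lt b d * lt a c) * x) (sym (□-swap₁₂,₃₄ a b c d)) ⟩
        H a b c d + H b a d c ∎
        where open ≡-Reasoning

  -- Each 4-cycle is traced by eight closed walks of length four.
  8#C₄≡∑ : ∑⁴ (λ a b c d → ne a c * ne b d * □ a b c d) ≡ 8 * #C₄ G
  8#C₄≡∑ = begin
    ∑⁴ (λ a b c d → ne a c * ne b d * □ a b c d)
      ≡⟨ ∑⁴-cong split ⟩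
    ∑⁴ (λ a b c d → K a b c d + K c b a d + (K a d c b + K c d a b))
      ≡⟨ trans (∑⁴-+ _ _) (cong₂ _+_ (∑⁴-+ _ _) (∑⁴-+ _ _)) ⟩
    ∑⁴ K + ∑⁴ (λ a b c d → K c b a d) + (∑⁴ (λ a b c d → K a d c b) + ∑⁴ (λ a b c d → K c d a b))
      ≡⟨ cong₂ _+_ (cong (∑⁴ K +_) (∑⁴-swap₁₃ K))
           (cong₂ _+_ (∑⁴-swap₂₄ K) (trans (∑⁴-swap₁₃ (λ a b c d → K a d c b)) (∑⁴-swap₂₄ K))) ⟩
    ∑⁴ K + ∑⁴ K + (∑⁴ K + ∑⁴ K)
      ≡⟨ cong (λ x → x + x + (x + x)) (trans ∑K≡2∑H (cong₂ _+_ (sym #C₄≡∑) (sym #C₄≡∑))) ⟩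
    q + q + (q + q) + (q + q + (q + q))
      ≡⟨ e q ⟩
    8 * q ∎
    where
    open ≡-Reasoning
    q : ℕ
    q = #C₄ G
    e : ∀ q → q + q + (q + q) + (q + q + (q + q)) ≡ 8 * q
    e = solve-∀
    e′ : ∀ x y u v f → (x + y) * (u + v) * f ≡ x * u * f + y * u * f + (x * v * f + y * v * f)
    e′ = solve-∀
    split : ∀ a b c d → ne a c * ne b d * □ a b c d ≡ K a b c d + K c b a d + (K a d c b + K c d a b)
    split a b c d = trans (e′ (lt a c) (lt c a) (lt b d) (lt d b) (□ a b c d))
      (cong₂ _+_ (cong (K a b c d +_) (cong (lt c a * lt b d *_) (sym (□-swap₁₃ a b c d))))
        (cong₂ _+_ (cong (lt a c * lt d b *_) (sym (□-swap₂₄ a b c d)))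
          (cong (lt c a * lt d b *_) (sym (trans (□-swap₁₃ a d c b) (□-swap₂₄ a b c d))))))

  -- A 4-cycle is determined by an edge and an oriented edge opposite to it.
  #C₄≤2m² : #C₄ G ≤ 2 * (#edges G * #edges G)
  #C₄≤2m² = begin
    #C₄ G
      ≡⟨ #C₄≡∑ ⟩
    ∑⁴ (λ a b c d → lt a b * (lt a c * lt b d) * □ a b c d)
      ≤⟨ ∑⁴-mono bound ⟩
    ∑⁴ (λ a b c d → (lt a b * adj a b) * adj c d)
      ≡⟨ (∑-cong λ a → ∑-cong λ b → trans (∑-cong λ c → sym (*-∑ (lt a b * adj a b) _)) (sym (*-∑ (lt a b * adj a b) _))) ⟩
    (∑[ a ] ∑[ b ] (lt a b * adj a b) * ∑ deg)
      ≡⟨ trans (∑-cong λ a → sym (∑-* _ _)) (sym (∑-* _ _)) ⟩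
    (∑[ a ] ∑[ b ] lt a b * adj a b) * ∑ deg
      ≡⟨ cong₂ _*_ (sym #edges≡∑) handshake ⟩
    #edges G * (2 * #edges G)
      ≡⟨ e (#edges G) ⟩
    2 * (#edges G * #edges G) ∎
    where
    open ≤-Reasoning
    e : ∀ m → m * (2 * m) ≡ 2 * (m * m)
    e = solve-∀
    e′ : ∀ x y z → (x * 1) * (y * (1 * (z * 1))) ≡ (x * y) * z
    e′ = solve-∀
    bound : ∀ a b c d → lt a b * (lt a c * lt b d) * □ a b c d ≤ (lt a b * adj a b) * adj c d
    bound a b c d = begin
      lt a b * (lt a c * lt b d) * (adj a b * (adj b c * (adj c d * adj d a)))
        ≤⟨ *-mono-≤ (*-monoʳ-≤ (lt a b) (*-mono-≤ (𝟙≤1 (a Fin.<? c)) (𝟙≤1 (b Fin.<? d))))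
             (*-monoʳ-≤ (adj a b) (*-mono-≤ (adj≤1 b c) (*-monoʳ-≤ (adj c d) (adj≤1 d a)))) ⟩
      lt a b * 1 * (adj a b * (1 * (adj c d * 1)))
        ≡⟨ e′ (lt a b) (adj a b) (adj c d) ⟩
      (lt a b * adj a b) * adj c d ∎

-- Gram matrices of graphs with few 4-cycles

-- The quadratic form yᵀMy and the squared norm of y.
form : (Fin n → Fin n → ℕ) → (Fin n → ℕ) → ℕ
form M y = ∑[ i ] y i * (∑[ j ] M i j * y j)

normSq : (Fin n → ℕ) → ℕ
normSq y = ∑[ i ] y i * y i

n*n≤n : ∀ {x} → x ≤ 1 → x * x ≤ x
n*n≤n z≤n       = z≤n
n*n≤n (s≤s z≤n) = ≤-refl

ne≤1 : (i j : Fin n) → ne i j ≤ 1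
ne≤1 i j = ≤-trans (m≤n+m (ne i j) (eq i j)) (≤-reflexive (eq+ne i j))

module _ {n : ℕ} (G : Graph n) where
  open Adjacency G

  private
    m q : ℕ
    m = #edges G
    q = #C₄ G

  -- b is a 0-1 matrix below the adjacency matrix, such as one of its blocks.
  module Gram (b : Fin n → Fin n → ℕ) (b≤adj : ∀ i j → b i j ≤ adj i j) where

    -- bᵀb
    gram : Fin n → Fin n → ℕ
    gram j k = ∑[ i ] b i j * b i k

    row col : Fin n → ℕ
    row i = ∑[ j ] b i j
    col j = ∑[ i ] b i j

    b≤1 : ∀ i j → b i j ≤ 1
    b≤1 i j = ≤-trans (b≤adj i j) (adj≤1 i j)

    gram-form : ∀ y → normSq (λ i → ∑[ j ] b i j * y j) ≡ form gram y
    gram-form y = begin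
      (∑[ i ] (∑[ j ] b i j * y j) * (∑[ k ] b i k * y k))
        ≡⟨ ∑-cong (λ i → ∑*∑ _ _) ⟩
      (∑[ i ] ∑[ j ] ∑[ k ] b i j * y j * (b i k * y k))
        ≡⟨ ∑-swap _ ⟩
      (∑[ j ] ∑[ i ] ∑[ k ] b i j * y j * (b i k * y k))
        ≡⟨ ∑-cong (λ j → ∑-swap _) ⟩
      (∑[ j ] ∑[ k ] ∑[ i ] b i j * y j * (b i k * y k))
        ≡⟨ ∑-cong (λ j → ∑-cong λ k → ∑-cong λ i → e (b i j) (y j) (b i k) (y k)) ⟩
      (∑[ j ] ∑[ k ] ∑[ i ] y j * (b i j * b i k * y k))
        ≡⟨ ∑-cong (λ j → ∑-cong λ k → trans (sym (*-∑ (y j) _)) (cong (y j *_) (sym (∑-* (y k) _)))) ⟩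
      (∑[ j ] ∑[ k ] y j * (gram j k * y k))
        ≡⟨ ∑-cong (λ j → sym (*-∑ (y j) _)) ⟩
      (∑[ j ] y j * (∑[ k ] gram j k * y k)) ∎
      where
      open ≡-Reasoning
      e : ∀ p q r s → p * q * (r * s) ≡ q * (p * r * s)
      e = solve-∀

    -- The Gram matrix with its diagonal removed.
    off : Fin n → Fin n → ℕ
    off j k = ne j k * gram j k

    gram-split : ∀ y → form gram y ≡ (∑[ j ] gram j j * (y j * y j)) + form off y
    gram-split y = trans (∑-cong λ j → trans
        (cong (y j *_) (trans (∑-split (λ k → gram j k * y k) j)
          (cong (gram j j * y j +_) (∑-cong λ k → sym (*-assoc (ne j k) (gram j k) (y k))))))
        (e (y j) (gram j j) (∑[ k ] off j k * y k)))
      (∑-+ _ _)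
      where
      e : ∀ y g o → y * (g * y + o) ≡ g * (y * y) + y * o
      e = solve-∀

    gram-diagonal : ∀ j → gram j j ≤ col j
    gram-diagonal j = ∑-mono λ i → n*n≤n (b≤1 i j)

    -- Squaring an off-diagonal entry counts the closed walks j i k i′ with
    -- j ≢ k.  Those with i ≢ i′ are 4-cycles, the others are counted by rows.
    off-frobenius : (∑[ j ] ∑[ k ] off j k * off j k) ≤ 8 * q + (∑[ i ] row i * row i)
    off-frobenius = begin
      (∑[ j ] ∑[ k ] off j k * off j k)
        ≤⟨ ∑-mono (λ j → ∑-mono λ k → pointwise j k) ⟩
      (∑[ j ] ∑[ k ] ((∑[ i ] b i j * b i k) + (∑[ i ] ∑[ i′ ] ne j k * ne i i′ * □ j i k i′)))
        ≡⟨ trans (∑-cong λ j → ∑-+ _ _) (∑-+ _ _) ⟩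
      (∑[ j ] ∑[ k ] ∑[ i ] b i j * b i k) + (∑[ j ] ∑[ k ] ∑[ i ] ∑[ i′ ] ne j k * ne i i′ * □ j i k i′)
        ≡⟨ cong₂ _+_ degenerate (trans (∑-cong λ j → ∑-swap _) 8#C₄≡∑) ⟩
      (∑[ i ] row i * row i) + 8 * q
        ≡⟨ +-comm (∑[ i ] row i * row i) (8 * q) ⟩
      8 * q + (∑[ i ] row i * row i) ∎
      where
      open ≤-Reasoning
      degenerate : (∑[ j ] ∑[ k ] ∑[ i ] b i j * b i k) ≡ ∑[ i ] row i * row i
      degenerate = trans (∑-cong λ j → ∑-swap _) (trans (∑-swap _) (∑-cong λ i → sym (∑*∑ _ _)))
      e₁ : ∀ x g → x * g * (x * g) ≡ x * x * (g * g)
      e₁ = solve-∀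
      walk : ∀ i i′ j k → b i j * b i k * (b i′ j * b i′ k) ≤ □ j i k i′
      walk i i′ j k = begin
        b i j * b i k * (b i′ j * b i′ k)
          ≤⟨ *-mono-≤ (*-mono-≤ (b≤adj i j) (b≤adj i k)) (*-mono-≤ (b≤adj i′ j) (b≤adj i′ k)) ⟩
        adj i j * adj i k * (adj i′ j * adj i′ k)
          ≡⟨ cong₂ (λ x y → x * adj i k * (adj i′ j * y)) (adj-sym i j) (adj-sym i′ k) ⟩
        adj j i * adj i k * (adj i′ j * adj k i′)
          ≡⟨ e (adj j i) (adj i k) (adj i′ j) (adj k i′) ⟩
        □ j i k i′ ∎
        where
        e : ∀ x y z w → x * y * (z * w) ≡ x * (y * (w * z))
        e = solve-∀
      inner : ∀ j k i → (∑[ i′ ] b i j * b i k * (b i′ j * b i′ k)) ≤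
        b i j * b i k + (∑[ i′ ] ne i i′ * □ j i k i′)
      inner j k i = begin
        (∑[ i′ ] b i j * b i k * (b i′ j * b i′ k))
          ≡⟨ ∑-split _ i ⟩
        b i j * b i k * (b i j * b i k) + (∑[ i′ ] ne i i′ * (b i j * b i k * (b i′ j * b i′ k)))
          ≤⟨ +-mono-≤ (n*n≤n (*-mono-≤ (b≤1 i j) (b≤1 i k)))
               (∑-mono λ i′ → *-monoʳ-≤ (ne i i′) (walk i i′ j k)) ⟩
        b i j * b i k + (∑[ i′ ] ne i i′ * □ j i k i′) ∎
      pointwise : ∀ j k → off j k * off j k ≤
        (∑[ i ] b i j * b i k) + (∑[ i ] ∑[ i′ ] ne j k * ne i i′ * □ j i k i′)
      pointwise j k = begin
        off j k * off j k
          ≡⟨ e₁ (ne j k) (gram j k) ⟩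
        ne j k * ne j k * (gram j k * gram j k)
          ≤⟨ *-mono-≤ (n*n≤n (ne≤1 j k)) (≤-reflexive (∑*∑ _ _)) ⟩
        ne j k * (∑[ i ] ∑[ i′ ] b i j * b i k * (b i′ j * b i′ k))
          ≤⟨ *-monoʳ-≤ (ne j k) (∑-mono (inner j k)) ⟩
        ne j k * (∑[ i ] (b i j * b i k + (∑[ i′ ] ne i i′ * □ j i k i′)))
          ≡⟨ trans (cong (ne j k *_) (∑-+ _ _)) (*-distribˡ-+ (ne j k) (gram j k) _) ⟩
        ne j k * gram j k + ne j k * (∑[ i ] ∑[ i′ ] ne i i′ * □ j i k i′)
          ≤⟨ +-mono-≤ (≤-trans (*-monoˡ-≤ (gram j k) (ne≤1 j k)) (≤-reflexive (*-identityˡ _)))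
               (≤-reflexive (trans (*-∑ (ne j k) _) (∑-cong λ i → trans (*-∑ (ne j k) _)
                 (∑-cong λ i′ → sym (*-assoc (ne j k) (ne i i′) _))))) ⟩
        gram j k + (∑[ i ] ∑[ i′ ] ne j k * ne i i′ * □ j i k i′) ∎

    -- If there are few 4-cycles and all rows are short, then the squared
    -- operator norm of b exceeds its largest column sum by at most m/t.
    gram-bound : ∀ t D y →
      16 * (t * t) * q ≤ m * m →
      (∀ i → 4 * (t * t) * row i ≤ m) →
      (∀ j → t * col j ≤ D) →
      t * normSq (λ i → ∑[ j ] b i j * y j) ≤ (D + m) * normSq y
    gram-bound t D y few rows cols = begin
      t * normSq (λ i → ∑[ j ] b i j * y j)
        ≡⟨ cong (t *_) (trans (gram-form y) (gram-split y)) ⟩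
      t * ((∑[ j ] gram j j * (y j * y j)) + form off y)
        ≡⟨ *-distribˡ-+ t _ _ ⟩
      t * (∑[ j ] gram j j * (y j * y j)) + t * form off y
        ≤⟨ +-mono-≤ diagonal off-diagonal ⟩
      D * s + m * s
        ≡⟨ sym (*-distribʳ-+ s D m) ⟩
      (D + m) * s ∎
      where
      open ≤-Reasoning
      s R κ : ℕ
      s = normSq y
      R = ∑[ i ] row i * row i
      κ = t * t
      diagonal : t * (∑[ j ] gram j j * (y j * y j)) ≤ D * s
      diagonal = begin
        t * (∑[ j ] gram j j * (y j * y j))
          ≡⟨ trans (*-∑ t _) (∑-cong λ j → sym (*-assoc t (gram j j) _)) ⟩
        (∑[ j ] t * gram j j * (y j * y j))
          ≤⟨ ∑-mono (λ j → *-monoˡ-≤ (y j * y j) (≤-trans (*-monoʳ-≤ t (gram-diagonal j)) (cols j))) ⟩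
        (∑[ j ] D * (y j * y j))
          ≡⟨ sym (*-∑ D _) ⟩
        D * s ∎
      rows-sum : ∑ row ≤ 2 * m
      rows-sum = ≤-trans (∑-mono λ i → ∑-mono λ j → b≤adj i j) (≤-reflexive handshake)
      R-bound : 2 * κ * R ≤ m * m
      R-bound = *-cancelˡ-≤ 2 (begin
        2 * (2 * κ * R)
          ≡⟨ e κ R ⟩
        4 * κ * R
          ≡⟨ trans (*-∑ (4 * κ) _) (∑-cong λ i → sym (*-assoc (4 * κ) (row i) (row i))) ⟩
        (∑[ i ] 4 * κ * row i * row i)
          ≤⟨ ∑-mono (λ i → *-monoˡ-≤ (row i) (rows i)) ⟩
        (∑[ i ] m * row i)
          ≡⟨ sym (*-∑ m _) ⟩
        m * ∑ row
          ≤⟨ *-monoʳ-≤ m rows-sum ⟩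
        m * (2 * m)
          ≡⟨ e′ m ⟩
        2 * (m * m) ∎)
        where
        e : ∀ κ R → 2 * (2 * κ * R) ≡ 4 * κ * R
        e = solve-∀
        e′ : ∀ m → m * (2 * m) ≡ 2 * (m * m)
        e′ = solve-∀
      few′ : κ * (8 * q + R) ≤ m * m
      few′ = *-cancelˡ-≤ 2 (begin
        2 * (κ * (8 * q + R))
          ≡⟨ e κ q R ⟩
        16 * κ * q + 2 * κ * R
          ≤⟨ +-mono-≤ few R-bound ⟩
        m * m + m * m
          ≡⟨ cong (m * m +_) (sym (+-identityʳ (m * m))) ⟩
        2 * (m * m) ∎)
        where
        e : ∀ κ q R → 2 * (κ * (8 * q + R)) ≡ 16 * κ * q + 2 * κ * R
        e = solve-∀
      off-diagonal : t * form off y ≤ m * s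
      off-diagonal = sq-cancel-≤ (begin
        t * O * (t * O)
          ≡⟨ e t O ⟩
        κ * (O * O)
          ≤⟨ *-monoʳ-≤ κ (≤-trans (frobenius off y) (*-monoʳ-≤ (s * s) off-frobenius)) ⟩
        κ * (s * s * (8 * q + R))
          ≡⟨ e′ κ (s * s) (8 * q + R) ⟩
        s * s * (κ * (8 * q + R))
          ≤⟨ *-monoʳ-≤ (s * s) few′ ⟩
        s * s * (m * m)
          ≡⟨ e″ s m ⟩
        m * s * (m * s) ∎)
        where
        O : ℕ
        O = form off y
        e : ∀ t O → t * O * (t * O) ≡ t * t * (O * O)
        e = solve-∀
        e′ : ∀ κ s x → κ * (s * x) ≡ s * (κ * x)
        e′ = solve-∀
        e″ : ∀ s m → s * s * (m * m) ≡ m * s * (m * s)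
        e″ = solve-∀

-- Rayleigh quotients of graphs without a dominating degree

[a+b]²≤2a²+2b² : ∀ a b → (a + b) * (a + b) ≤ 2 * (a * a) + 2 * (b * b)
[a+b]²≤2a²+2b² a b = begin
  (a + b) * (a + b)                         ≡⟨ e a b ⟩
  2 * (a * b) + (a * a + b * b)             ≤⟨ +-monoˡ-≤ (a * a + b * b) (2ab≤a²+b² a b) ⟩
  a * a + b * b + (a * a + b * b)           ≡⟨ e′ (a * a) (b * b) ⟩
  2 * (a * a) + 2 * (b * b)                 ∎
  where
  open ≤-Reasoning
  e : ∀ a b → (a + b) * (a + b) ≡ 2 * (a * b) + (a * a + b * b)
  e = solve-∀
  e′ : ∀ x y → x + y + (x + y) ≡ 2 * x + 2 * y
  e′ = solve-∀

𝟙-weaken : ∀ {P : Set} {x y} (d : Dec P) k → (P → k * x ≤ y) → k * (𝟙 d * x) ≤ y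
𝟙-weaken {x = x} (yes p) k f = ≤-trans (≤-reflexive (cong (k *_) (*-identityˡ x))) (f p)
𝟙-weaken         (no _)  k f = ≤-trans (≤-reflexive (*-zeroʳ k)) z≤n

-- The quotient (2P + Q)/s cannot reach p/q > √m if Q/s is at most √m/K and
-- 2P/s is at most √(cm/K), because the condition on c says √(c/K) < 1 - 1/K.
rayleigh-contradiction : ∀ K′ c m s p q P Q →
  let K = suc K′ in
  K * c < K′ * K′ →
  K * Q * (K * Q) ≤ m * (s * s) →
  4 * (K * (P * P)) ≤ c * m * (s * s) →
  q * q * m < p * p → 0 < s →
  ¬ p * s ≤ q * (2 * P + Q)
rayleigh-contradiction K′ c m s p q P Q Kc<K′² hQ hP q²m<p² 0<s h =
  contradiction K′²≤Kc (<⇒≱ Kc<K′²)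
  where
  open ≤-Reasoning
  K : ℕ
  K = suc K′
  instance
    0<ps : NonZero (p * s * (p * s))
    0<ps = >-nonZero (*-mono-≤ {1} {_} {1} 0<ps′ 0<ps′)
      where
      0<p : 0 < p
      0<p = n≢0⇒n>0 λ where refl → contradiction q²m<p² λ ()
      0<ps′ : 0 < p * s
      0<ps′ = *-mono-≤ {1} {_} {1} 0<p 0<s
  q²ms²≤ : q * q * m * (s * s) ≤ p * s * (p * s)
  q²ms²≤ = ≤-trans (*-monoˡ-≤ (s * s) (<⇒≤ q²m<p²)) (≤-reflexive (e p s))
    where
    e : ∀ p s → p * p * (s * s) ≡ p * s * (p * s)
    e = solve-∀
  KqQ≤ps : K * (q * Q) ≤ p * s
  KqQ≤ps = sq-cancel-≤ (begin
    K * (q * Q) * (K * (q * Q))    ≡⟨ e K q Q ⟩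
    q * q * (K * Q * (K * Q))      ≤⟨ *-monoʳ-≤ (q * q) hQ ⟩
    q * q * (m * (s * s))          ≡⟨ *-assoc (q * q) m (s * s) ⟨
    q * q * m * (s * s)            ≤⟨ q²ms²≤ ⟩
    p * s * (p * s)                ∎)
    where
    e : ∀ K q Q → K * (q * Q) * (K * (q * Q)) ≡ q * q * (K * Q * (K * Q))
    e = solve-∀
  K′ps≤ : K′ * (p * s) ≤ 2 * (K * (q * P))
  K′ps≤ = +-cancelˡ-≤ (p * s) _ _ (begin
    K * (p * s)                              ≤⟨ *-monoʳ-≤ K h ⟩
    K * (q * (2 * P + Q))                    ≡⟨ e K q P Q ⟩
    K * (q * Q) + 2 * (K * (q * P))          ≤⟨ +-monoˡ-≤ (2 * (K * (q * P))) KqQ≤ps ⟩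
    p * s + 2 * (K * (q * P))                ∎)
    where
    e : ∀ K q P Q → K * (q * (2 * P + Q)) ≡ K * (q * Q) + 2 * (K * (q * P))
    e = solve-∀
  K′²≤Kc : K′ * K′ ≤ K * c
  K′²≤Kc = *-cancelʳ-≤ _ _ (p * s * (p * s)) (begin
    K′ * K′ * (p * s * (p * s))                   ≡⟨ e K′ (p * s) ⟩
    K′ * (p * s) * (K′ * (p * s))                 ≤⟨ *-mono-≤ K′ps≤ K′ps≤ ⟩
    2 * (K * (q * P)) * (2 * (K * (q * P)))       ≡⟨ e′ K q P ⟩
    K * (q * q) * (4 * (K * (P * P)))             ≤⟨ *-monoʳ-≤ (K * (q * q)) hP ⟩
    K * (q * q) * (c * m * (s * s))               ≡⟨ e″ K (q * q) c m (s * s) ⟩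
    K * c * (q * q * m * (s * s))                 ≤⟨ *-monoʳ-≤ (K * c) q²ms²≤ ⟩
    K * c * (p * s * (p * s))                     ∎)
    where
    e : ∀ K x → K * K * (x * x) ≡ K * x * (K * x)
    e = solve-∀
    e′ : ∀ K q P → 2 * (K * (q * P)) * (2 * (K * (q * P))) ≡ K * (q * q) * (4 * (K * (P * P)))
    e′ = solve-∀
    e″ : ∀ K q c m s → K * q * (c * m * s) ≡ K * c * (q * m * s)
    e″ = solve-∀

module _ {n : ℕ} (G : Graph n) where
  open Adjacency G

  private
    m : ℕ
    m = #edges G

  -- With K = K′ + 1, t = 16τ and κ = t², the block high-high and the block
  -- low-low each contribute at most √m|y|²/2K to yᵀAy, and the squared norm of
  -- the block high-low is at most cm/K.
  module BoundedDegrees (K′ c τ : ℕ)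
    (Kc<K′² : suc K′ * c < K′ * K′)
    (K[15τ+1]≤16cτ : suc K′ * (15 * τ + 1) ≤ c * (16 * τ))
    (8K²≤t : 8 * (suc K′ * suc K′) ≤ 16 * τ)
    (few : 16 * ((16 * τ) * (16 * τ)) * #C₄ G ≤ m * m)
    (large : 256 * (suc K′ * suc K′) *
             (((16 * τ) * (16 * τ)) * ((16 * τ) * (16 * τ))) ≤ m)
    (0<m : 0 < m)
    (deg≤ : ∀ i → 16 * deg i ≤ 15 * m)
    (y : Fin n → ℕ)
    where

    private
      K t κ : ℕ
      K = suc K′
      t = 16 * τ
      κ = t * t

      -- l and h are the indicators of the vertices of degree at most,
      -- respectively more than, m/4κ.
      low? : ∀ i → Dec (4 * κ * deg i ≤ m)
      low? i = 4 * κ * deg i ≤? m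

      l h : Fin n → ℕ
      l i = 𝟙 (low? i)
      h i = 𝟙 (¬? (low? i))

      𝟙+𝟙¬ : ∀ {P : Set} (d : Dec P) → 𝟙 (¬? d) + 𝟙 d ≡ 1
      𝟙+𝟙¬ (yes _) = refl
      𝟙+𝟙¬ (no  _) = refl

      -- The restrictions of y to the low and to the high vertices.
      yᴸ yᴴ : Fin n → ℕ
      yᴸ i = l i * y i
      yᴴ i = h i * y i

      l≤1 : ∀ i → l i ≤ 1
      l≤1 i = 𝟙≤1 (low? i)
      h≤1 : ∀ i → h i ≤ 1
      h≤1 i = 𝟙≤1 (¬? (low? i))

      s sᴸ sᴴ : ℕ
      s  = normSq y
      sᴸ = normSq yᴸ
      sᴴ = normSq yᴴ

      sᴸ+sᴴ≡s : sᴸ + sᴴ ≡ s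
      sᴸ+sᴴ≡s = trans (sym (∑-+ _ _)) (∑-cong λ i → split (low? i) (y i))
        where
        split : ∀ {P : Set} (d : Dec P) y →
          𝟙 d * y * (𝟙 d * y) + 𝟙 (¬? d) * y * (𝟙 (¬? d) * y) ≡ y * y
        split (yes _) y = e y
          where
          e : ∀ y → 1 * y * (1 * y) + 0 * y * (0 * y) ≡ y * y
          e = solve-∀
        split (no  _) y = e y
          where
          e : ∀ y → 0 * y * (0 * y) + 1 * y * (1 * y) ≡ y * y
          e = solve-∀

      instance
        m≢0 : NonZero m
        m≢0 = >-nonZero 0<m

      1≤t : 1 ≤ t
      1≤t = ≤-trans (s≤s z≤n) 8K²≤t

      t≤4κ : t ≤ 4 * κ
      t≤4κ = begin
        t             ≡⟨ *-identityˡ t ⟨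
        1 * t         ≤⟨ *-monoˡ-≤ t 1≤t ⟩
        κ             ≤⟨ m≤m+n κ _ ⟩
        4 * κ         ∎
        where open ≤-Reasoning

      -- There are boundedly many vertices of high degree.
      ∑h≤8κ : ∑ h ≤ 8 * κ
      ∑h≤8κ = *-cancelʳ-≤ _ _ m (begin
        ∑ h * m                            ≡⟨ ∑-* m h ⟩
        (∑[ i ] h i * m)                   ≤⟨ ∑-mono high ⟩
        (∑[ i ] 4 * κ * deg i)             ≡⟨ sym (*-∑ (4 * κ) deg) ⟩
        4 * κ * ∑ deg                      ≡⟨ cong (4 * κ *_) handshake ⟩
        4 * κ * (2 * m)                    ≡⟨ e κ m ⟩
        8 * κ * m                          ∎)
        where
        open ≤-Reasoning
        e : ∀ κ m → 4 * κ * (2 * m) ≡ 8 * κ * m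
        e = solve-∀
        high : ∀ i → h i * m ≤ 4 * κ * deg i
        high i = begin
          h i * m          ≡⟨ *-identityˡ (h i * m) ⟨
          1 * (h i * m)    ≤⟨ 𝟙-weaken (¬? (low? i)) 1 (λ ¬low → ≤-trans (≤-reflexive (*-identityˡ m)) (<⇒≤ (≰⇒> ¬low))) ⟩
          4 * κ * deg i    ∎

      l-deg : ∀ i → 4 * κ * (l i * deg i) ≤ m
      l-deg i = 𝟙-weaken (low? i) (4 * κ) λ low → low

      -- The block low-low of the adjacency matrix.
      bᴸ : Fin n → Fin n → ℕ
      bᴸ i j = l i * (adj i j * l j)

      bᴸ≤l*adj : ∀ i j → bᴸ i j ≤ l i * adj i j
      bᴸ≤l*adj i j = *-monoʳ-≤ (l i) (≤-trans (*-monoʳ-≤ (adj i j) (l≤1 j)) (≤-reflexive (*-identityʳ _)))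

      bᴸ-sym : ∀ i j → bᴸ i j ≡ bᴸ j i
      bᴸ-sym i j = trans (cong (λ x → l i * (x * l j)) (adj-sym i j)) (e (l i) (adj j i) (l j))
        where
        e : ∀ x a y → x * (a * y) ≡ y * (a * x)
        e = solve-∀

      Qᴸ : ℕ
      Qᴸ = form bᴸ y

      Qᴸ-bound : 2 * K * Qᴸ * (2 * K * Qᴸ) ≤ m * (s * s)
      Qᴸ-bound = *-cancelˡ-≤ 2 (begin
        2 * (2 * K * Qᴸ * (2 * K * Qᴸ))
          ≡⟨ e K Qᴸ ⟩
        8 * (K * K) * (Qᴸ * Qᴸ)
          ≤⟨ *-mono-≤ 8K²≤t (cauchy-schwarz y (λ i → ∑[ j ] bᴸ i j * y j)) ⟩
        t * (s * F)
          ≡⟨ e′ t s F ⟩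
        s * (t * F)
          ≤⟨ *-monoʳ-≤ s (gram-bound t m y few rows cols) ⟩
        s * ((m + m) * s)
          ≡⟨ e″ s m ⟩
        2 * (m * (s * s)) ∎)
        where
        open ≤-Reasoning
        open Gram G bᴸ (λ i j → ≤-trans (bᴸ≤l*adj i j)
          (≤-trans (*-monoˡ-≤ (adj i j) (l≤1 i)) (≤-reflexive (*-identityˡ _))))
        F : ℕ
        F = normSq (λ i → ∑[ j ] bᴸ i j * y j)
        rows : ∀ i → 4 * κ * row i ≤ m
        rows i = ≤-trans (*-monoʳ-≤ (4 * κ) (≤-trans (∑-mono (bᴸ≤l*adj i)) (≤-reflexive (sym (*-∑ (l i) _)))))
          (l-deg i)
        cols : ∀ j → t * col j ≤ m
        cols j = ≤-trans (*-mono-≤ t≤4κ (≤-reflexive (∑-cong λ i → bᴸ-sym i j))) (rows j)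
        e : ∀ K Q → 2 * (2 * K * Q * (2 * K * Q)) ≡ 8 * (K * K) * (Q * Q)
        e = solve-∀
        e′ : ∀ t s F → t * (s * F) ≡ s * (t * F)
        e′ = solve-∀
        e″ : ∀ s m → s * ((m + m) * s) ≡ 2 * (m * (s * s))
        e″ = solve-∀

      -- The block high-high.
      bᴴ : Fin n → Fin n → ℕ
      bᴴ i j = h i * (adj i j * h j)

      Qᴴ : ℕ
      Qᴴ = form bᴴ y

      Qᴴ-bound : 2 * K * Qᴴ * (2 * K * Qᴴ) ≤ m * (s * s)
      Qᴴ-bound = begin
        2 * K * Qᴴ * (2 * K * Qᴴ)
          ≡⟨ e K Qᴴ ⟩
        4 * (K * K) * (Qᴴ * Qᴴ)
          ≤⟨ *-monoʳ-≤ (4 * (K * K)) (≤-trans (frobenius bᴴ y) (*-monoʳ-≤ (s * s) N-bound)) ⟩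
        4 * (K * K) * (s * s * (8 * κ * (8 * κ)))
          ≡⟨ e′ (K * K) (s * s) κ ⟩
        256 * (K * K) * (κ * κ) * (s * s)
          ≤⟨ *-monoˡ-≤ (s * s) large ⟩
        m * (s * s) ∎
        where
        open ≤-Reasoning
        e : ∀ K Q → 2 * K * Q * (2 * K * Q) ≡ 4 * (K * K) * (Q * Q)
        e = solve-∀
        e′ : ∀ K s κ → 4 * K * (s * (8 * κ * (8 * κ))) ≡ 256 * K * (κ * κ) * s
        e′ = solve-∀
        entry : ∀ i j → bᴴ i j * bᴴ i j ≤ h i * h j
        entry i j = begin
          bᴴ i j * bᴴ i j           ≤⟨ n*n≤n (*-mono-≤ (h≤1 i) (*-mono-≤ (adj≤1 i j) (h≤1 j))) ⟩
          h i * (adj i j * h j)     ≤⟨ *-monoʳ-≤ (h i) (*-monoˡ-≤ (h j) (adj≤1 i j)) ⟩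
          h i * (1 * h j)           ≡⟨ cong (h i *_) (*-identityˡ (h j)) ⟩
          h i * h j                 ∎
        N-bound : (∑[ i ] ∑[ j ] bᴴ i j * bᴴ i j) ≤ 8 * κ * (8 * κ)
        N-bound = begin
          (∑[ i ] ∑[ j ] bᴴ i j * bᴴ i j)    ≤⟨ ∑-mono (λ i → ∑-mono (entry i)) ⟩
          (∑[ i ] ∑[ j ] h i * h j)          ≡⟨ sym (∑*∑ h h) ⟩
          ∑ h * ∑ h                          ≤⟨ *-mono-≤ ∑h≤8κ ∑h≤8κ ⟩
          8 * κ * (8 * κ)                    ∎

      -- The columns of the adjacency matrix at high vertices.  The block high-low
      -- arises by pairing it with a vector supported on low vertices.
      bᴾ : Fin n → Fin n → ℕ
      bᴾ i j = adj i j * h j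

      bᴾ≤adj : ∀ i j → bᴾ i j ≤ adj i j
      bᴾ≤adj i j = ≤-trans (*-monoʳ-≤ (adj i j) (h≤1 j)) (≤-reflexive (*-identityʳ _))

      P : ℕ
      P = ∑[ i ] yᴸ i * (∑[ j ] bᴾ i j * yᴴ j)

      P-bound : 4 * (K * (P * P)) ≤ c * m * (s * s)
      P-bound = begin
        4 * (K * (P * P))
          ≤⟨ *-monoʳ-≤ 4 (*-monoʳ-≤ K (cauchy-schwarz yᴸ (λ i → ∑[ j ] bᴾ i j * yᴴ j))) ⟩
        4 * (K * (sᴸ * F))
          ≡⟨ e K sᴸ F ⟩
        4 * (sᴸ * (K * F))
          ≤⟨ *-monoʳ-≤ 4 (*-monoʳ-≤ sᴸ KF≤) ⟩
        4 * (sᴸ * (c * m * sᴴ))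
          ≡⟨ e′ sᴸ (c * m) sᴴ ⟩
        c * m * (4 * (sᴸ * sᴴ))
          ≤⟨ *-monoʳ-≤ (c * m) (4ab≤[a+b]² sᴸ sᴴ) ⟩
        c * m * ((sᴸ + sᴴ) * (sᴸ + sᴴ))
          ≡⟨ cong (λ x → c * m * (x * x)) sᴸ+sᴴ≡s ⟩
        c * m * (s * s) ∎
        where
        open ≤-Reasoning
        open Gram G bᴾ bᴾ≤adj
        F : ℕ
        F = normSq (λ i → ∑[ j ] bᴾ i j * yᴴ j)
        e : ∀ K s F → 4 * (K * (s * F)) ≡ 4 * (s * (K * F))
        e = solve-∀
        e′ : ∀ s x s′ → 4 * (s * (x * s′)) ≡ x * (4 * (s * s′))
        e′ = solve-∀
        rows : ∀ i → 4 * κ * row i ≤ m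
        rows i = begin
          4 * κ * row i
            ≤⟨ *-monoʳ-≤ (4 * κ) (∑-mono λ j → ≤-trans (*-monoˡ-≤ (h j) (adj≤1 i j)) (≤-reflexive (*-identityˡ (h j)))) ⟩
          4 * κ * ∑ h
            ≤⟨ *-monoʳ-≤ (4 * κ) ∑h≤8κ ⟩
          4 * κ * (8 * κ)
            ≡⟨ e₁ κ ⟩
          32 * (κ * κ)
            ≤⟨ *-monoˡ-≤ (κ * κ) (≤-trans (m≤m*n 32 (8 * (K * K))) (≤-reflexive (e₂ (K * K)))) ⟩
          256 * (K * K) * (κ * κ)
            ≤⟨ large ⟩
          m ∎
          where
          e₁ : ∀ κ → 4 * κ * (8 * κ) ≡ 32 * (κ * κ)
          e₁ = solve-∀
          e₂ : ∀ x → 32 * (8 * x) ≡ 256 * x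
          e₂ = solve-∀
        cols : ∀ j → t * col j ≤ 15 * τ * m
        cols j = begin
          t * col j              ≤⟨ *-monoʳ-≤ t (∑-mono λ i → bᴾ≤adj i j) ⟩
          t * (∑[ i ] adj i j)   ≡⟨ cong (t *_) (∑-cong λ i → adj-sym i j) ⟩
          16 * τ * deg j         ≡⟨ e₁ τ (deg j) ⟩
          τ * (16 * deg j)       ≤⟨ *-monoʳ-≤ τ (deg≤ j) ⟩
          τ * (15 * m)           ≡⟨ e₂ τ m ⟩
          15 * τ * m             ∎
          where
          e₁ : ∀ τ d → 16 * τ * d ≡ τ * (16 * d)
          e₁ = solve-∀
          e₂ : ∀ τ d → τ * (15 * d) ≡ 15 * τ * d
          e₂ = solve-∀
        KF≤ : K * F ≤ c * m * sᴴ
        KF≤ = *-cancelˡ-≤ t {{>-nonZero 1≤t}} (begin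
          t * (K * F)
            ≡⟨ e₁ t K F ⟩
          K * (t * F)
            ≤⟨ *-monoʳ-≤ K (gram-bound t (15 * τ * m) yᴴ few rows cols) ⟩
          K * ((15 * τ * m + m) * sᴴ)
            ≡⟨ e₂ K τ m sᴴ ⟩
          K * (15 * τ + 1) * (m * sᴴ)
            ≤⟨ *-monoˡ-≤ (m * sᴴ) K[15τ+1]≤16cτ ⟩
          c * t * (m * sᴴ)
            ≡⟨ e₃ c t m sᴴ ⟩
          t * (c * m * sᴴ) ∎)
          where
          e₁ : ∀ t K F → t * (K * F) ≡ K * (t * F)
          e₁ = solve-∀
          e₂ : ∀ K τ m s → K * ((15 * τ * m + m) * s) ≡ K * (15 * τ + 1) * (m * s)
          e₂ = solve-∀
          e₃ : ∀ c t m s → c * t * (m * s) ≡ t * (c * m * s)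
          e₃ = solve-∀

      -- The two off-diagonal blocks contribute equally by symmetry.
      decompose : form adj y ≡ 2 * P + (Qᴴ + Qᴸ)
      decompose = begin
        form adj y
          ≡⟨ expand adj y y ⟩
        (∑[ i ] ∑[ j ] y i * (adj i j * y j))
          ≡⟨ ∑-cong (λ i → ∑-cong λ j → entry i j) ⟩
        (∑[ i ] ∑[ j ] (yᴸ i * (bᴾ i j * yᴴ j) + yᴸ j * (bᴾ j i * yᴴ i)
                        + (y i * (bᴴ i j * y j) + y i * (bᴸ i j * y j))))
          ≡⟨ trans (∑-cong λ i → trans (∑-+ _ _) (cong₂ _+_ (∑-+ _ _) (∑-+ _ _)))
               (trans (∑-+ _ _) (cong₂ _+_ (∑-+ _ _) (∑-+ _ _))) ⟩
        (∑[ i ] ∑[ j ] yᴸ i * (bᴾ i j * yᴴ j)) + (∑[ i ] ∑[ j ] yᴸ j * (bᴾ j i * yᴴ i))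
          + ((∑[ i ] ∑[ j ] y i * (bᴴ i j * y j)) + (∑[ i ] ∑[ j ] y i * (bᴸ i j * y j)))
          ≡⟨ cong₂ _+_ (cong₂ _+_ (sym (expand bᴾ yᴸ yᴴ)) (trans (∑-swap _) (sym (expand bᴾ yᴸ yᴴ))))
               (cong₂ _+_ (sym (expand bᴴ y y)) (sym (expand bᴸ y y))) ⟩
        P + P + (Qᴴ + Qᴸ)
          ≡⟨ cong (λ x → P + x + (Qᴴ + Qᴸ)) (sym (+-identityʳ P)) ⟩
        2 * P + (Qᴴ + Qᴸ) ∎
        where
        open ≡-Reasoning
        expand : ∀ (M : Fin n → Fin n → ℕ) (x z : Fin n → ℕ) →
          (∑[ i ] x i * (∑[ j ] M i j * z j)) ≡ (∑[ i ] ∑[ j ] x i * (M i j * z j))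
        expand M x z = ∑-cong λ i → *-∑ (x i) _
        unit : ∀ i → h i + l i ≡ 1
        unit i = 𝟙+𝟙¬ (low? i)
        e : ∀ h l h′ l′ y y′ a →
          (h + l) * y * (a * ((h′ + l′) * y′)) ≡
          l * y * (a * h′ * y′) + l′ * y′ * (a * h * y) + (y * (h * (a * h′) * y′) + y * (l * (a * l′) * y′))
        e = solve-∀
        idem : ∀ i → h i * y i ≡ h i * yᴴ i
        idem i = trans (cong (_* y i) (sym (𝟙-idem (¬? (low? i))))) (*-assoc (h i) (h i) (y i))
        pull : ∀ i j → adj i j * h j * y j ≡ bᴾ i j * yᴴ j
        pull i j = trans (*-assoc (adj i j) (h j) (y j)) (trans (cong (adj i j *_) (idem j))
          (sym (*-assoc (adj i j) (h j) (yᴴ j))))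
        entry : ∀ i j → y i * (adj i j * y j) ≡
          yᴸ i * (bᴾ i j * yᴴ j) + yᴸ j * (bᴾ j i * yᴴ i) + (y i * (bᴴ i j * y j) + y i * (bᴸ i j * y j))
        entry i j = begin
          y i * (adj i j * y j)
            ≡⟨ cong₂ (λ u v → u * (adj i j * v)) (one i) (one j) ⟩
          (h i + l i) * y i * (adj i j * ((h j + l j) * y j))
            ≡⟨ e (h i) (l i) (h j) (l j) (y i) (y j) (adj i j) ⟩
          l i * y i * (adj i j * h j * y j) + l j * y j * (adj i j * h i * y i) + rest
            ≡⟨ cong₂ (λ u v → l i * y i * u + l j * y j * v + rest) (pull i j)
                 (trans (cong (λ a → a * h i * y i) (adj-sym i j)) (pull j i)) ⟩
          yᴸ i * (bᴾ i j * yᴴ j) + yᴸ j * (bᴾ j i * yᴴ i) + rest ∎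
          where
          rest : ℕ
          rest = y i * (bᴴ i j * y j) + y i * (bᴸ i j * y j)
          one : ∀ i → y i ≡ (h i + l i) * y i
          one i = trans (sym (*-identityˡ (y i))) (cong (_* y i) (sym (unit i)))

    rayleigh-small : ∀ p q → q * q * m < p * p → 0 < normSq y →
      ¬ p * normSq y ≤ q * form adj y
    rayleigh-small p q q²m<p² 0<s ps≤ =
      rayleigh-contradiction K′ c m s p q P (Qᴴ + Qᴸ) Kc<K′² Q-bound P-bound q²m<p² 0<s
        (≤-trans ps≤ (≤-reflexive (cong (q *_) decompose)))
      where
      open ≤-Reasoning
      e : ∀ K x y → 4 * (K * (x + y) * (K * (x + y))) ≡ (2 * K * x + 2 * K * y) * (2 * K * x + 2 * K * y)
      e = solve-∀
      e′ : ∀ x → 2 * x + 2 * x ≡ 4 * x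
      e′ = solve-∀
      Q-bound : K * (Qᴴ + Qᴸ) * (K * (Qᴴ + Qᴸ)) ≤ m * (s * s)
      Q-bound = *-cancelˡ-≤ 4 (begin
        4 * (K * (Qᴴ + Qᴸ) * (K * (Qᴴ + Qᴸ)))
          ≡⟨ e K Qᴴ Qᴸ ⟩
        (2 * K * Qᴴ + 2 * K * Qᴸ) * (2 * K * Qᴴ + 2 * K * Qᴸ)
          ≤⟨ [a+b]²≤2a²+2b² (2 * K * Qᴴ) (2 * K * Qᴸ) ⟩
        2 * (2 * K * Qᴴ * (2 * K * Qᴴ)) + 2 * (2 * K * Qᴸ * (2 * K * Qᴸ))
          ≤⟨ +-mono-≤ (*-monoʳ-≤ 2 Qᴴ-bound) (*-monoʳ-≤ 2 Qᴸ-bound) ⟩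
        2 * (m * (s * s)) + 2 * (m * (s * s))
          ≡⟨ e′ (m * (s * s)) ⟩
        4 * (m * (s * s)) ∎)

-- Graphs with a dominating degree

module _ {n : ℕ} (G : Graph n) where
  open Adjacency G

  private
    m : ℕ
    m = #edges G

  -- The entry (Ay)ᵢ, the sum of y over the neighbours of i.
  nbr : (Fin n → ℕ) → Fin n → ℕ
  nbr y i = ∑[ j ] adj i j * y j

  nbr-mono : ∀ {y z} → (∀ i → y i ≤ z i) → ∀ i → nbr y i ≤ nbr z i
  nbr-mono y≤z i = ∑-mono λ j → *-monoʳ-≤ (adj i j) (y≤z j)

  nbr-≤ : ∀ {y x} → (∀ i → y i ≤ x) → ∀ i → nbr y i ≤ deg i * x
  nbr-≤ {y} {x} y≤x i = ≤-trans (nbr-mono y≤x i) (≤-reflexive (sym (∑-* x (adj i))))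

  nbr-+ : ∀ y z i → nbr (λ j → y j + z j) i ≡ nbr y i + nbr z i
  nbr-+ y z i = trans (∑-cong λ j → *-distribˡ-+ (adj i j) (y j) (z j)) (∑-+ _ _)

  nbr-* : ∀ k y i → nbr (λ j → k * y j) i ≡ k * nbr y i
  nbr-* k y i = trans (∑-cong λ j → e (adj i j) k (y j)) (sym (*-∑ k _))
    where
    e : ∀ a k y → a * (k * y) ≡ k * (a * y)
    e = solve-∀

  deg≤n : ∀ i → deg i ≤ n
  deg≤n i = ≤-trans (∑-mono (adj≤1 i)) (≤-reflexive (trans (∑-const n 1) (*-identityʳ n)))

  module AlmostStar (u : Fin n) (15m≤16deg : 15 * m ≤ 16 * deg u) where

    -- deg′ is the degree after the removal of u, and excess is twice the number
    -- of edges that avoid u.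
    deg′ : Fin n → ℕ
    deg′ z = ∑[ v ] ne u v * adj z v

    excess : ℕ
    excess = ∑[ z ] ne u z * deg′ z

    deg-split : ∀ z → deg z ≡ adj z u + deg′ z
    deg-split z = ∑-split (adj z) u

    2deg+excess : 2 * deg u + excess ≡ 2 * m
    2deg+excess = begin
      2 * deg u + excess
        ≡⟨ e (deg u) excess ⟩
      deg u + (deg u + excess)
        ≡⟨ cong (λ x → deg u + (x + excess)) (sym others) ⟩
      deg u + ((∑[ z ] ne u z * adj z u) + excess)
        ≡⟨ cong (deg u +_) (sym (∑-+ _ _)) ⟩
      deg u + (∑[ z ] (ne u z * adj z u + ne u z * deg′ z))
        ≡⟨ cong (deg u +_) (∑-cong λ z → trans (sym (*-distribˡ-+ (ne u z) (adj z u) (deg′ z)))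
             (cong (ne u z *_) (sym (deg-split z)))) ⟩
      deg u + (∑[ z ] ne u z * deg z)
        ≡⟨ sym (∑-split deg u) ⟩
      ∑ deg
        ≡⟨ handshake ⟩
      2 * m ∎
      where
      open ≡-Reasoning
      e : ∀ d x → 2 * d + x ≡ d + (d + x)
      e = solve-∀
      others : (∑[ z ] ne u z * adj z u) ≡ deg u
      others = ∑-cong λ z → trans (cong (ne u z *_) (adj-sym z u)) (ne*adj u z)

    8excess≤m : 8 * excess ≤ m
    8excess≤m = *-cancelˡ-≤ 2 (+-cancelˡ-≤ (30 * m) _ _ (begin
      30 * m + 2 * (8 * excess)             ≡⟨ e₁ m excess ⟩
      2 * (15 * m) + 16 * excess            ≤⟨ +-monoˡ-≤ (16 * excess) (*-monoʳ-≤ 2 15m≤16deg) ⟩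
      2 * (16 * deg u) + 16 * excess        ≡⟨ e₂ (deg u) excess ⟩
      16 * (2 * deg u + excess)             ≡⟨ cong (16 *_) 2deg+excess ⟩
      16 * (2 * m)                          ≡⟨ e₃ m ⟩
      30 * m + 2 * m                        ∎))
      where
      open ≤-Reasoning
      e₁ : ∀ m x → 30 * m + 2 * (8 * x) ≡ 2 * (15 * m) + 16 * x
      e₁ = solve-∀
      e₂ : ∀ d x → 2 * (16 * d) + 16 * x ≡ 16 * (2 * d + x)
      e₂ = solve-∀
      e₃ : ∀ m → 16 * (2 * m) ≡ 30 * m + 2 * m
      e₃ = solve-∀

    deg′≤excess : ∀ {w} → u ≢ w → deg′ w ≤ excess
    deg′≤excess {w} u≢w = begin
      deg′ w               ≡⟨ *-identityˡ (deg′ w) ⟨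
      1 * deg′ w           ≡⟨ cong (_* deg′ w) (≢⇒ne≡1 u≢w) ⟨
      ne u w * deg′ w      ≤⟨ term≤∑ _ w ⟩
      excess               ∎
      where open ≤-Reasoning

    -- x is an upper bound of y, later its maximum, and L is so large that the
    -- error (qn + p)x accumulated over two steps is at most Lx/16.
    module _ {p q L x : ℕ} {y : Fin n → ℕ}
      (256≤m : 256 ≤ m)
      (q²m<p² : q * q * m < p * p)
      (L-large : 16 * (q * n + p) ≤ L)
      (y≤x : ∀ i → y i ≤ x)
      (sub : ∀ i → L * (p * y i) ≤ L * (q * nbr y i) + x)
      where

      private
        open ≤-Reasoning

        0<p : 0 < p
        0<p = n≢0⇒n>0 λ where refl → contradiction q²m<p² λ ()

        0<p² : 0 < p * p
        0<p² = *-mono-≤ {1} {_} {1} 0<p 0<p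

        0<L : 0 < L
        0<L = ≤-trans (≤-trans 0<p (m≤n+m p (q * n))) (≤-trans (m≤n*m (q * n + p) 16) L-large)

        instance
          p²≢0 : NonZero (p * p)
          p²≢0 = >-nonZero 0<p²
          L≢0 : NonZero L
          L≢0 = >-nonZero 0<L

        16q≤p : 16 * q ≤ p
        16q≤p = sq-cancel-≤ (begin
          16 * q * (16 * q)      ≡⟨ e q ⟩
          q * q * 256            ≤⟨ *-monoʳ-≤ (q * q) 256≤m ⟩
          q * q * m              ≤⟨ <⇒≤ q²m<p² ⟩
          p * p                  ∎)
          where
          e : ∀ q → 16 * q * (16 * q) ≡ q * q * 256
          e = solve-∀

        nbr-x : ∀ i → nbr (λ _ → x) i ≤ n * x
        nbr-x i = ≤-trans (nbr-≤ {λ _ → x} {x} (λ _ → ≤-refl) i) (*-monoˡ-≤ x (deg≤n i))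

        -- One step of the inequality satisfied by y, prepared for a second one.
        sub₁ : ∀ w → L * (p * p * y w) ≤ q * nbr (λ z → L * (p * y z)) w + p * x
        sub₁ w = begin
          L * (p * p * y w)                                ≡⟨ e L p (y w) ⟩
          p * (L * (p * y w))                              ≤⟨ *-monoʳ-≤ p (sub w) ⟩
          p * (L * (q * nbr y w) + x)                      ≡⟨ e′ p L q (nbr y w) x ⟩
          q * (L * (p * nbr y w)) + p * x                  ≡⟨ cong (λ z → q * (L * z) + p * x) (nbr-* p y w) ⟨
          q * (L * nbr (λ z → p * y z) w) + p * x          ≡⟨ cong (λ z → q * z + p * x) (nbr-* L (λ z → p * y z) w) ⟨
          q * nbr (λ z → L * (p * y z)) w + p * x          ∎
          where
          e : ∀ L p y → L * (p * p * y) ≡ p * (L * (p * y))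
          e = solve-∀
          e′ : ∀ p L q b x → p * (L * (q * b) + x) ≡ q * (L * (p * b)) + p * x
          e′ = solve-∀

        -- Away from u, a neighbour contributes at most its degree.
        step : ∀ w → u ≢ w →
          nbr (λ z → L * (p * y z)) w ≤ L * (p * x) + (L * q * (2 * excess) + n) * x
        step w u≢w = begin
          nbr (λ z → L * (p * y z)) w
            ≡⟨ ∑-split _ u ⟩
          adj w u * (L * (p * y u)) + (∑[ z ] ne u z * (adj w z * (L * (p * y z))))
            ≤⟨ +-mono-≤ (≤-trans (*-mono-≤ (adj≤1 w u) (*-monoʳ-≤ L (*-monoʳ-≤ p (y≤x u)))) (≤-reflexive (*-identityˡ _)))
                 (∑-mono λ z → *-monoʳ-≤ (ne u z) (*-monoʳ-≤ (adj w z)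
                   (≤-trans (sub z) (+-monoˡ-≤ x (*-monoʳ-≤ L (*-monoʳ-≤ q (nbr-≤ y≤x z))))))) ⟩
          L * (p * x) + (∑[ z ] ne u z * (adj w z * (L * (q * (deg z * x)) + x)))
            ≡⟨ cong (L * (p * x) +_) (∑-cong λ z → e (ne u z) (adj w z) L q (deg z) x) ⟩
          L * (p * x) + (∑[ z ] (L * q * (ne u z * (adj w z * deg z)) + ne u z * adj w z) * x)
            ≡⟨ cong (L * (p * x) +_) (trans (sym (∑-* x _)) (cong (_* x) (trans (∑-+ _ _) (cong (_+ deg′ w) (sym (*-∑ (L * q) _)))))) ⟩
          L * (p * x) + (L * q * (∑[ z ] ne u z * (adj w z * deg z)) + deg′ w) * x
            ≤⟨ +-monoʳ-≤ (L * (p * x)) (*-monoˡ-≤ x (+-mono-≤ (*-monoʳ-≤ (L * q) two-steps) deg′≤n)) ⟩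
          L * (p * x) + (L * q * (2 * excess) + n) * x ∎
          where
          e : ∀ o a L q d x → o * (a * (L * (q * (d * x)) + x)) ≡ (L * q * (o * (a * d)) + o * a) * x
          e = solve-∀
          e′ : ∀ o a b d → o * (a * (b + d)) ≡ o * a * b + a * (o * d)
          e′ = solve-∀
          deg′≤n : deg′ w ≤ n
          deg′≤n = ≤-trans (≤-trans (m≤n+m (deg′ w) (adj w u)) (≤-reflexive (sym (deg-split w)))) (deg≤n w)
          two-steps : (∑[ z ] ne u z * (adj w z * deg z)) ≤ 2 * excess
          two-steps = begin
            (∑[ z ] ne u z * (adj w z * deg z))
              ≡⟨ ∑-cong (λ z → trans (cong (λ d → ne u z * (adj w z * d)) (deg-split z))
                   (e′ (ne u z) (adj w z) (adj z u) (deg′ z))) ⟩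
            (∑[ z ] (ne u z * adj w z * adj z u + adj w z * (ne u z * deg′ z)))
              ≤⟨ ∑-mono (λ z → +-mono-≤
                   (≤-trans (*-monoʳ-≤ (ne u z * adj w z) (adj≤1 z u)) (≤-reflexive (*-identityʳ _)))
                   (≤-trans (*-monoˡ-≤ (ne u z * deg′ z) (adj≤1 w z)) (≤-reflexive (*-identityˡ _)))) ⟩
            (∑[ z ] (ne u z * adj w z + ne u z * deg′ z))
              ≡⟨ ∑-+ _ _ ⟩
            deg′ w + excess
              ≤⟨ +-monoˡ-≤ excess (deg′≤excess u≢w) ⟩
            excess + excess
              ≡⟨ cong (excess +_) (sym (+-identityʳ excess)) ⟩
            2 * excess ∎

      -- Lp²y(w) is at most the sum of Lpqx ≤ Lp²x/16 for the walks through u, of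
      -- Lp²x/4 for the walks avoiding u, and of the error, at most Lp²x/16.
      2y≤x : ∀ w → u ≢ w → 2 * y w ≤ x
      2y≤x w u≢w = *-cancelˡ-≤ 8 (*-cancelˡ-≤ (p * p) (*-cancelˡ-≤ L (begin
        L * (p * p * (8 * (2 * y w)))
          ≡⟨ e₁ L (p * p) (y w) ⟩
        16 * (L * (p * p * y w))
          ≤⟨ *-monoʳ-≤ 16 (≤-trans (sub₁ w) (+-monoˡ-≤ (p * x) (*-monoʳ-≤ q (step w u≢w)))) ⟩
        16 * (q * (L * (p * x) + (L * q * (2 * excess) + n) * x) + p * x)
          ≡⟨ e₂ q L p x excess n ⟩
        L * (16 * q * p * x) + 4 * L * (q * q * (8 * excess)) * x + 16 * (q * n + p) * x
          ≤⟨ +-mono-≤ (+-mono-≤ (*-monoʳ-≤ L (*-monoˡ-≤ x (*-monoˡ-≤ p 16q≤p)))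
                        (*-monoˡ-≤ x (*-monoʳ-≤ (4 * L) excess-small)))
               (*-monoˡ-≤ x (≤-trans L-large (m≤m*n L (p * p)))) ⟩
        L * (p * p * x) + 4 * L * (p * p) * x + L * (p * p) * x
          ≤⟨ m≤m+n _ (2 * L * (p * p) * x) ⟩
        L * (p * p * x) + 4 * L * (p * p) * x + L * (p * p) * x + 2 * L * (p * p) * x
          ≡⟨ e₃ L (p * p) x ⟩
        L * (p * p * (8 * x)) ∎)))
        where
        e₁ : ∀ L P y → L * (P * (8 * (2 * y))) ≡ 16 * (L * (P * y))
        e₁ = solve-∀
        e₂ : ∀ q L p x E n → 16 * (q * (L * (p * x) + (L * q * (2 * E) + n) * x) + p * x) ≡
          L * (16 * q * p * x) + 4 * L * (q * q * (8 * E)) * x + 16 * (q * n + p) * x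
        e₂ = solve-∀
        e₃ : ∀ L P x → L * (P * x) + 4 * L * P * x + L * P * x + 2 * L * P * x ≡ L * (P * (8 * x))
        e₃ = solve-∀
        excess-small : q * q * (8 * excess) ≤ p * p
        excess-small = ≤-trans (*-monoʳ-≤ (q * q) 8excess≤m) (<⇒≤ q²m<p²)

      -- Two steps from u: the walks back to u number deg u, and every other
      -- walk has weight at most one half.
      2nbr²≤2mx : 2 * nbr (nbr y) u ≤ 2 * m * x
      2nbr²≤2mx = begin
        2 * nbr (nbr y) u
          ≡⟨ *-∑ 2 _ ⟩
        (∑[ z ] 2 * (adj u z * nbr y z))
          ≤⟨ ∑-mono walk ⟩
        (∑[ z ] (2 * adj u z + ne u z * deg′ z) * x)
          ≡⟨ trans (sym (∑-* x _)) (cong (_* x) (trans (∑-+ _ _) (cong (_+ excess) (sym (*-∑ 2 (adj u)))))) ⟩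
        (2 * deg u + excess) * x
          ≡⟨ cong (_* x) 2deg+excess ⟩
        2 * m * x ∎
        where
        e₁ : ∀ a y B → 2 * (a * (y + B)) ≡ a * (2 * y) + a * (2 * B)
        e₁ = solve-∀
        e₂ : ∀ o a y → 2 * (o * (a * y)) ≡ a * (o * (2 * y))
        e₂ = solve-∀
        e₃ : ∀ a o d x → a * (2 * x) + o * (d * x) ≡ (2 * a + o * d) * x
        e₃ = solve-∀
        e₄ : ∀ a o x → a * (o * x) ≡ o * a * x
        e₄ = solve-∀
        half : ∀ v → ne u v * (2 * y v) ≤ ne u v * x
        half v with u Fin.≟ v
        ... | yes refl = ≤-reflexive (cong₂ _*_ (ne-irrefl u) refl ⟨ trans ⟩ sym (cong (_* x) (ne-irrefl u)))
        ... | no  u≢v  = *-monoʳ-≤ (ne u v) (2y≤x v u≢v)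
        adj≤ne : ∀ z → adj u z ≤ ne u z
        adj≤ne z = ≤-trans (≤-reflexive (sym (ne*adj u z)))
          (≤-trans (*-monoʳ-≤ (ne u z) (adj≤1 u z)) (≤-reflexive (*-identityʳ _)))
        away : ∀ z → 2 * (∑[ v ] ne u v * (adj z v * y v)) ≤ deg′ z * x
        away z = begin
          2 * (∑[ v ] ne u v * (adj z v * y v))
            ≡⟨ trans (*-∑ 2 _) (∑-cong λ v → e₂ (ne u v) (adj z v) (y v)) ⟩
          (∑[ v ] adj z v * (ne u v * (2 * y v)))
            ≤⟨ ∑-mono (λ v → *-monoʳ-≤ (adj z v) (half v)) ⟩
          (∑[ v ] adj z v * (ne u v * x))
            ≡⟨ trans (∑-cong λ v → e₄ (adj z v) (ne u v) x) (sym (∑-* x _)) ⟩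
          deg′ z * x ∎
        walk : ∀ z → 2 * (adj u z * nbr y z) ≤ (2 * adj u z + ne u z * deg′ z) * x
        walk z = begin
          2 * (adj u z * nbr y z)
            ≡⟨ cong (λ b → 2 * (adj u z * b)) (∑-split _ u) ⟩
          2 * (adj u z * (adj z u * y u + (∑[ v ] ne u v * (adj z v * y v))))
            ≡⟨ e₁ (adj u z) (adj z u * y u) _ ⟩
          adj u z * (2 * (adj z u * y u)) + adj u z * (2 * (∑[ v ] ne u v * (adj z v * y v)))
            ≤⟨ +-mono-≤
                 (*-monoʳ-≤ (adj u z) (*-monoʳ-≤ 2 (≤-trans (*-mono-≤ (adj≤1 z u) (y≤x u)) (≤-reflexive (*-identityˡ x)))))
                 (*-mono-≤ (adj≤ne z) (away z)) ⟩
          adj u z * (2 * x) + ne u z * (deg′ z * x)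
            ≡⟨ e₃ (adj u z) (ne u z) (deg′ z) x ⟩
          (2 * adj u z + ne u z * deg′ z) * x ∎

      -- p² ≥ q²m + 1 leaves a gap of L, which exceeds the accumulated error C.
      maximum-not-at-u : 0 < x → y u ≢ x
      maximum-not-at-u 0<x yu≡x = <⇒≱ C<L L≤C
        where
        C : ℕ
        C = q * n + p
        C<L : C < L
        C<L = begin-strict
          C              <⟨ m<m+n C (≤-trans 0<p (m≤n+m p (q * n))) ⟩
          C + C          ≤⟨ m≤m+n (C + C) (14 * C) ⟩
          C + C + 14 * C ≡⟨ e C ⟩
          16 * C         ≤⟨ L-large ⟩
          L              ∎
          where
          e : ∀ C → C + C + 14 * C ≡ 16 * C
          e = solve-∀
        from-u : nbr (λ z → L * (p * y z)) u ≤ L * (q * nbr (nbr y) u) + n * x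
        from-u = begin
          nbr (λ z → L * (p * y z)) u
            ≤⟨ nbr-mono sub u ⟩
          nbr (λ z → L * (q * nbr y z) + x) u
            ≡⟨ nbr-+ (λ z → L * (q * nbr y z)) (λ _ → x) u ⟩
          nbr (λ z → L * (q * nbr y z)) u + nbr (λ _ → x) u
            ≡⟨ cong (_+ nbr (λ _ → x) u) (trans (nbr-* L _ u) (cong (L *_) (nbr-* q _ u))) ⟩
          L * (q * nbr (nbr y) u) + nbr (λ _ → x) u
            ≤⟨ +-monoʳ-≤ (L * (q * nbr (nbr y) u)) (nbr-x u) ⟩
          L * (q * nbr (nbr y) u) + n * x ∎
        L≤C : L ≤ C
        L≤C = +-cancelˡ-≤ (L * (q * q * m)) _ _ (*-cancelʳ-≤ _ _ x {{>-nonZero 0<x}} (*-cancelˡ-≤ 2 (begin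
          2 * ((L * (q * q * m) + L) * x)
            ≡⟨ e₁ L (q * q * m) x ⟩
          2 * (L * (suc (q * q * m) * x))
            ≤⟨ *-monoʳ-≤ 2 (*-monoʳ-≤ L (*-mono-≤ q²m<p² (≤-reflexive (sym yu≡x)))) ⟩
          2 * (L * (p * p * y u))
            ≤⟨ *-monoʳ-≤ 2 (≤-trans (sub₁ u) (+-monoˡ-≤ (p * x) (*-monoʳ-≤ q from-u))) ⟩
          2 * (q * (L * (q * nbr (nbr y) u) + n * x) + p * x)
            ≡⟨ e₂ q L (nbr (nbr y) u) n x p ⟩
          L * (q * q) * (2 * nbr (nbr y) u) + 2 * (C * x)
            ≤⟨ +-monoˡ-≤ (2 * (C * x)) (*-monoʳ-≤ (L * (q * q)) 2nbr²≤2mx) ⟩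
          L * (q * q) * (2 * m * x) + 2 * (C * x)
            ≡⟨ e₃ L (q * q) m x C ⟩
          2 * ((L * (q * q * m) + C) * x) ∎)))
          where
          e₁ : ∀ L M x → 2 * ((L * M + L) * x) ≡ 2 * (L * ((1 + M) * x))
          e₁ = solve-∀
          e₂ : ∀ q L B n x p → 2 * (q * (L * (q * B) + n * x) + p * x) ≡
            L * (q * q) * (2 * B) + 2 * ((q * n + p) * x)
          e₂ = solve-∀
          e₃ : ∀ L Q m x C → L * Q * (2 * m * x) + 2 * (C * x) ≡ 2 * ((L * (Q * m) + C) * x)
          e₃ = solve-∀

      no-maximum : 0 < x → ¬ (∃[ w ] y w ≡ x)
      no-maximum 0<x (w , yw≡x) with u Fin.≟ w
      ... | no u≢w = <⇒≱ (m<m+n x (≤-trans 0<x (m≤m+n x 0)))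
        (≤-trans (≤-reflexive (cong (2 *_) (sym yw≡x))) (2y≤x w u≢w))
      ... | yes refl = maximum-not-at-u 0<x yw≡x

-- Subeigenvectors and the number of 4-cycles

maximum : ∀ {n} (f : Fin n → ℕ) → Fin n → ∃[ w ] ∀ i → f i ≤ f w
maximum {n} f k = argmax f k (allFin n) ,
  λ i → All.lookup (f[xs]≤f[argmax] {f = f} k (allFin n)) (∈-allFin i)

-- A vector y of natural numbers with Ay ≥ (r/q)y up to an error: every
-- r yᵢ − q(Ay)ᵢ is at most 1/L times a fixed positive entry of y.
record ApproxSubeigenvector {n} (G : Graph n) (r q L : ℕ) : Set where
  field
    vec      : Fin n → ℕ
    index    : Fin n
    positive : 0 < vec index
    sub      : ∀ i → L * (r * vec i) ≤ L * (q * nbr G vec i) + vec index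

-- The values of K′, c and τ in BoundedDegrees.  They are opaque so that no
-- multiple of such a constant is ever unfolded into a sum.
opaque
  K₀ c₀ τ₀ : ℕ
  K₀ = 63
  c₀ = 61
  τ₀ = 2048

  K₀c₀-bound : suc K₀ * c₀ < K₀ * K₀
  K₀c₀-bound = ≤ᵇ⇒≤ _ _ _

  K₀τ₀-bound : suc K₀ * (15 * τ₀ + 1) ≤ c₀ * (16 * τ₀)
  K₀τ₀-bound = ≤ᵇ⇒≤ _ _ _

  τ₀-bound : 8 * (suc K₀ * suc K₀) ≤ 16 * τ₀
  τ₀-bound = ≤ᵇ⇒≤ _ _ _

-- A graph with m ≥ size-bound edges and λ > √m has more than m² / C₄-factor
-- cycles of length four.
κ₀ C₄-factor size-bound : ℕ
κ₀         = (16 * τ₀) * (16 * τ₀)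
C₄-factor  = 16 * κ₀
size-bound = 256 * (suc K₀ * suc K₀) * (κ₀ * κ₀)

256≤size-bound : 256 ≤ size-bound
256≤size-bound = begin
  256                                  ≡⟨⟩
  256 * 1 * 1                          ≤⟨ *-mono-≤ (*-monoʳ-≤ 256 {1} {suc K₀ * suc K₀} (s≤s z≤n)) (*-mono-≤ {1} {_} {1} 1≤κ₀ 1≤κ₀) ⟩
  256 * (suc K₀ * suc K₀) * (κ₀ * κ₀)  ∎
  where
  open ≤-Reasoning
  1≤16τ₀ : 1 ≤ 16 * τ₀
  1≤16τ₀ = ≤-trans (*-mono-≤ {1} {8} {1} (s≤s z≤n) (s≤s z≤n)) τ₀-bound
  1≤κ₀ : 1 ≤ κ₀
  1≤κ₀ = *-mono-≤ {1} {_} {1} 1≤16τ₀ 1≤16τ₀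

module _ {n : ℕ} (G : Graph n) where
  open Adjacency G

  private
    m : ℕ
    m = #edges G

  -- A sufficient accuracy: the first summand serves AlmostStar, the second one
  -- absorbs the error in the Rayleigh quotient.
  accuracy : ℕ → ℕ → ℕ
  accuracy p q = 16 * (q * n + p) + suc n

  many-C₄ : size-bound ≤ m → ∀ p q → q * q * m < p * p →
    ApproxSubeigenvector G (suc p) q (accuracy p q) → ¬ C₄-factor * #C₄ G ≤ m * m
  many-C₄ large p q q²m<p² y few with Fin.any? (λ u → 15 * m ≤? 16 * deg u)
  ... | yes (u , 15m≤16deg) = AlmostStar.no-maximum G u 15m≤16deg {p} {q} {L} {vec (proj₁ top)} {vec}
        (≤-trans 256≤size-bound large) q²m<p² (m≤m+n (16 * (q * n + p)) (suc n))
        (proj₂ top) sub′ (<-≤-trans positive (proj₂ top index)) (proj₁ top , refl)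
    where
    open ApproxSubeigenvector y
    top : ∃[ w ] ∀ i → vec i ≤ vec w
    top = maximum vec index
    L : ℕ
    L = accuracy p q
    sub′ : ∀ i → L * (p * vec i) ≤ L * (q * nbr G vec i) + vec (proj₁ top)
    sub′ i = ≤-trans (*-monoʳ-≤ L (m≤n+m (p * vec i) (vec i)))
      (≤-trans (sub i) (+-monoʳ-≤ (L * (q * nbr G vec i)) (proj₂ top index)))
  ... | no ¬large = BoundedDegrees.rayleigh-small G K₀ c₀ τ₀ K₀c₀-bound K₀τ₀-bound τ₀-bound
        few large (≤-trans (s≤s z≤n) (≤-trans 256≤size-bound large))
        (λ i → <⇒≤ (≰⇒> λ h → ¬large (i , h))) vec p q q²m<p² 0<s ps≤
    where
    open ApproxSubeigenvector y
    open ≤-Reasoning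
    L s : ℕ
    L = accuracy p q
    s = normSq vec
    yₖ²≤s : vec index * vec index ≤ s
    yₖ²≤s = term≤∑ (λ i → vec i * vec i) index
    0<s : 0 < s
    0<s = ≤-trans (*-mono-≤ {1} {_} {1} positive positive) yₖ²≤s
    -- The error in yᵀAy, by yᵢyₖ ≤ yᵢ² + yₖ².
    error : (∑[ i ] vec i * vec index) ≤ L * s
    error = begin
      (∑[ i ] vec i * vec index)
        ≤⟨ ∑-mono (λ i → ≤-trans (m≤n*m _ 2) (2ab≤a²+b² (vec i) (vec index))) ⟩
      (∑[ i ] (vec i * vec i + vec index * vec index))
        ≡⟨ trans (∑-+ _ _) (cong (s +_) (∑-const n _)) ⟩
      s + n * (vec index * vec index)
        ≤⟨ +-monoʳ-≤ s (*-monoʳ-≤ n yₖ²≤s) ⟩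
      suc n * s
        ≤⟨ *-monoˡ-≤ s (m≤n+m (suc n) (16 * (q * n + p))) ⟩
      L * s ∎
    ps≤ : p * s ≤ q * form adj vec
    ps≤ = *-cancelˡ-≤ L {{>-nonZero (≤-trans (s≤s z≤n) (m≤n+m (suc n) (16 * (q * n + p))))}}
      (+-cancelʳ-≤ (L * s) _ _ (begin
        L * (p * s) + L * s
          ≡⟨ e L p s ⟩
        L * suc p * s
          ≡⟨ trans (*-∑ (L * suc p) _) (∑-cong λ i → e′ L (suc p) (vec i)) ⟩
        (∑[ i ] vec i * (L * (suc p * vec i)))
          ≤⟨ ∑-mono (λ i → *-monoʳ-≤ (vec i) (sub i)) ⟩
        (∑[ i ] vec i * (L * (q * nbr G vec i) + vec index))
          ≡⟨ trans (∑-cong λ i → e″ (vec i) L q (nbr G vec i) (vec index)) (trans (∑-+ _ _)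
               (cong (_+ (∑[ i ] vec i * vec index)) (sym (*-∑ (L * q) _)))) ⟩
        L * q * form adj vec + (∑[ i ] vec i * vec index)
          ≤⟨ +-monoʳ-≤ (L * q * form adj vec) error ⟩
        L * q * form adj vec + L * s
          ≡⟨ cong (_+ L * s) (*-assoc L q (form adj vec)) ⟩
        L * (q * form adj vec) + L * s ∎))
      where
      e : ∀ L p s → L * (p * s) + L * s ≡ L * (1 + p) * s
      e = solve-∀
      e′ : ∀ L p y → L * p * (y * y) ≡ y * (L * (p * y))
      e′ = solve-∀
      e″ : ∀ y L q b k → y * (L * (q * b) + k) ≡ L * q * (y * b) + y * k
      e″ = solve-∀

-- Natural numbers as rationals

-- The embedding of ℕ into ℚ.  It is opaque to keep the normalisation of
-- fractions out of conversion checking.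
opaque
  ι : ℕ → ℚ
  ι n = pos n ℚ./ 1

  ι-def : ∀ n → pos n ℚ./ 1 ≡ ι n
  ι-def n = refl

  toℚᵘ-ι : ∀ n → toℚᵘ (ι n) ℚᵘ.≃ mkℚᵘ (pos n) 0
  toℚᵘ-ι n = ℚ.toℚᵘ-fromℚᵘ (mkℚᵘ (pos n) 0)

ι-* : ∀ a b → ι (a * b) ≡ ι a *ᵠ ι b
ι-* a b = ℚ.toℚᵘ-injective (ℚᵘ.≃-trans (toℚᵘ-ι (a * b))
  (ℚᵘ.≃-trans (ℚᵘ.*≡* (cong (ℤ._* pos 1) (ℤ.pos-* a b)))
  (ℚᵘ.≃-sym (ℚᵘ.≃-trans (ℚ.toℚᵘ-homo-* (ι a) (ι b)) (ℚᵘ.*-cong (toℚᵘ-ι a) (toℚᵘ-ι b))))))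

ι-+ : ∀ a b → ι (a + b) ≡ ι a +ᵠ ι b
ι-+ a b = ℚ.toℚᵘ-injective (ℚᵘ.≃-trans (toℚᵘ-ι (a + b))
  (ℚᵘ.≃-trans (ℚᵘ.*≡* (cong (ℤ._* pos 1) (trans (ℤ.pos-+ a b)
    (sym (cong₂ ℤ._+_ (ℤ.*-identityʳ (pos a)) (ℤ.*-identityʳ (pos b)))))))
  (ℚᵘ.≃-sym (ℚᵘ.≃-trans (ℚ.toℚᵘ-homo-+ (ι a) (ι b)) (ℚᵘ.+-cong (toℚᵘ-ι a) (toℚᵘ-ι b))))))

ι-mono : ∀ {a b} → a ≤ b → ι a ≤ᵠ ι b
ι-mono {a} {b} a≤b = ℚ.toℚᵘ-cancel-≤ (ℚᵘ.≤-trans (ℚᵘ.≤-reflexive (toℚᵘ-ι a))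
  (ℚᵘ.≤-trans (ℚᵘ.*≤* (ℤ.*-monoʳ-≤-nonNeg (pos 1) (ℤ.+≤+ a≤b)))
    (ℚᵘ.≤-reflexive (ℚᵘ.≃-sym (toℚᵘ-ι b)))))

ι-cancel : ∀ {a b} → ι a ≤ᵠ ι b → a ≤ b
ι-cancel {a} {b} h
  with ℚᵘ.≤-trans (ℚᵘ.≤-reflexive (ℚᵘ.≃-sym (toℚᵘ-ι a)))
         (ℚᵘ.≤-trans (ℚ.toℚᵘ-mono-≤ h) (ℚᵘ.≤-reflexive (toℚᵘ-ι b)))
... | ℚᵘ.*≤* le = ℤ.drop‿+≤+ (subst₂ ℤ._≤_ (ℤ.*-identityʳ (pos a)) (ℤ.*-identityʳ (pos b)) le)

ι0≡0 : ι 0 ≡ 0ℚ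
ι0≡0 = sym (ι-def 0)

ι1≡1 : ι 1 ≡ 1ℚ
ι1≡1 = sym (ι-def 1)

0≤ι : ∀ a → 0ℚ ≤ᵠ ι a
0≤ι a = subst (_≤ᵠ ι a) ι0≡0 (ι-mono z≤n)

0<ι : ∀ {a} → 0 < a → 0ℚ <ᵠ ι a
0<ι 0<a = ℚ.<-≤-trans (ℚ.positive⁻¹ 1ℚ) (ℚ.≤-trans (ℚ.≤-reflexive (sym ι1≡1)) (ι-mono 0<a))

-- If x = a / (d+1) then (d+1) x = a.
ι-clear : ∀ x a d → toℚᵘ x ℚᵘ.≃ mkℚᵘ (pos a) d → ι (suc d) *ᵠ x ≡ ι a
ι-clear x a d x≃ = ℚ.toℚᵘ-injective (ℚᵘ.≃-trans (ℚ.toℚᵘ-homo-* (ι (suc d)) x)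
  (ℚᵘ.≃-trans (ℚᵘ.*-cong (toℚᵘ-ι (suc d)) x≃)
  (ℚᵘ.≃-trans (ℚᵘ.*≡* cross) (ℚᵘ.≃-sym (toℚᵘ-ι a)))))
  where
  cross : pos (suc d) ℤ.* pos a ℤ.* pos 1 ≡ pos a ℤ.* pos (1 * suc d)
  cross = trans (ℤ.*-identityʳ (pos (suc d) ℤ.* pos a)) (trans (ℤ.*-comm (pos (suc d)) (pos a))
    (cong (λ z → pos a ℤ.* pos z) (sym (*-identityˡ (suc d)))))

ι-clear-/ : ∀ a d → ι (suc d) *ᵠ (pos a ℚ./ suc d) ≡ ι a
ι-clear-/ a d = ι-clear _ a d (ℚ.toℚᵘ-fromℚᵘ (mkℚᵘ (pos a) d))

-- Order on the rationals

*ᵠ-monoʳ : ∀ {r p q} → 0ℚ ≤ᵠ r → p ≤ᵠ q → r *ᵠ p ≤ᵠ r *ᵠ q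
*ᵠ-monoʳ {r} 0≤r = ℚ.*-monoˡ-≤-nonNeg r {{ℚ.nonNegative 0≤r}}

*ᵠ-monoˡ : ∀ {r p q} → 0ℚ ≤ᵠ r → p ≤ᵠ q → p *ᵠ r ≤ᵠ q *ᵠ r
*ᵠ-monoˡ {r} 0≤r = ℚ.*-monoʳ-≤-nonNeg r {{ℚ.nonNegative 0≤r}}

half : ℚ → ℚ
half ε = ½ *ᵠ ε

half-pos : ∀ {ε} → 0ℚ <ᵠ ε → 0ℚ <ᵠ half ε
half-pos {ε} 0<ε = ℚ.positive⁻¹ (½ *ᵠ ε) {{ℚ.pos*pos⇒pos ½ ε {{ℚ.positive 0<ε}}}}

half+half : ∀ ε → half ε +ᵠ half ε ≡ ε
half+half ε = trans (sym (ℚ.*-distribʳ-+ ε ½ ½)) (ℚ.*-identityˡ ε)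

half≤ : ∀ {ε} → 0ℚ <ᵠ ε → half ε ≤ᵠ ε
half≤ {ε} 0<ε = begin
  half ε                 ≡⟨ ℚ.+-identityʳ (half ε) ⟨
  half ε +ᵠ 0ℚ           ≤⟨ ℚ.+-monoʳ-≤ (half ε) (ℚ.<⇒≤ (half-pos 0<ε)) ⟩
  half ε +ᵠ half ε       ≡⟨ half+half ε ⟩
  ε                      ∎
  where open ℚ.≤-Reasoning

p≤∣p∣ : ∀ p → p ≤ᵠ ∣ p ∣
p≤∣p∣ p with ℚ.≤-total 0ℚ p
... | inj₁ 0≤p = ℚ.≤-reflexive (sym (ℚ.0≤p⇒∣p∣≡p 0≤p))
... | inj₂ p≤0 = ℚ.≤-trans p≤0 (ℚ.0≤∣p∣ p)

-- ∣p − q∣ ≤ δ gives p ≤ q + δ.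
∣-∣⇒≤ : ∀ {p q δ} → ∣ p -ᵠ q ∣ ≤ᵠ δ → p ≤ᵠ q +ᵠ δ
∣-∣⇒≤ {p} {q} {δ} h = begin
  p                ≡⟨ split p q ⟩
  q +ᵠ (p -ᵠ q)    ≤⟨ ℚ.+-monoʳ-≤ q (ℚ.≤-trans (p≤∣p∣ (p -ᵠ q)) h) ⟩
  q +ᵠ δ           ∎
  where
  open ℚ.≤-Reasoning
  open ℚ-Solver.+-*-Solver
  split : ∀ p q → p ≡ q +ᵠ (p -ᵠ q)
  split = solve 2 (λ p q → p := q :+ (p :- q)) refl

archimedes : ∀ {ε} → 0ℚ <ᵠ ε → ∃[ N ] ι 1 ≤ᵠ ι N *ᵠ ε
archimedes {ε@(mkℚ (pos (suc a)) d _)} 0<ε = suc d ,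
  ℚ.≤-trans (ι-mono (s≤s z≤n)) (ℚ.≤-reflexive (sym (ι-clear ε (suc a) d ℚᵘ.≃-refl)))
archimedes {mkℚ (pos 0) _ _} (*<* (ℤ.+<+ ()))
archimedes {mkℚ -[1+ _ ] _ _} (*<* ())

-- Finite families of rationals

∑ᵠ : ∀ {n} → (Fin n → ℚ) → ℚ
∑ᵠ {zero}  f = 0ℚ
∑ᵠ {suc n} f = f zero +ᵠ ∑ᵠ (f ∘ suc)

∑ᵠ-cong : {f g : Fin n → ℚ} → (∀ i → f i ≡ g i) → ∑ᵠ f ≡ ∑ᵠ g
∑ᵠ-cong {zero}  e = refl
∑ᵠ-cong {suc n} e = cong₂ _+ᵠ_ (e zero) (∑ᵠ-cong (e ∘ suc))

∣∑ᵠ∣≤∑ᵠ∣∣ : (f : Fin n → ℚ) → ∣ ∑ᵠ f ∣ ≤ᵠ ∑ᵠ (λ i → ∣ f i ∣)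
∣∑ᵠ∣≤∑ᵠ∣∣ {zero}  f = ℚ.≤-refl
∣∑ᵠ∣≤∑ᵠ∣∣ {suc n} f = ℚ.≤-trans (ℚ.∣p+q∣≤∣p∣+∣q∣ (f zero) (∑ᵠ (f ∘ suc)))
  (ℚ.+-monoʳ-≤ ∣ f zero ∣ (∣∑ᵠ∣≤∑ᵠ∣∣ (f ∘ suc)))

∑ᵠ-ι : (f : Fin n → ℕ) → ∑ᵠ (ι ∘ f) ≡ ι (∑ f)
∑ᵠ-ι {zero}  f = sym (trans (cong ι (∑-zero f)) ι0≡0)
∑ᵠ-ι {suc n} f = trans (cong (ι (f zero) +ᵠ_) (∑ᵠ-ι (f ∘ suc)))
  (sym (trans (cong ι (∑-suc f)) (ι-+ (f zero) _)))

*-∑ᵠ : ∀ c (f : Fin n → ℚ) → c *ᵠ ∑ᵠ f ≡ ∑ᵠ (λ i → c *ᵠ f i)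
*-∑ᵠ {zero}  c f = ℚ.*-zeroʳ c
*-∑ᵠ {suc n} c f = trans (ℚ.*-distribˡ-+ c (f zero) _) (cong (c *ᵠ f zero +ᵠ_) (*-∑ᵠ c (f ∘ suc)))

-- Finitely many nonnegative rationals have a common denominator.
clear-denominators : (y : Fin n → ℚ) → (∀ i → 0ℚ ≤ᵠ y i) →
  ∃[ D ] 0 < D × (Σ[ Y ∈ (Fin n → ℕ) ] ∀ i → ι D *ᵠ y i ≡ ι (Y i))
clear-denominators {zero}  y 0≤y = 1 , s≤s z≤n , (λ ()) , λ ()
clear-denominators {suc n} y 0≤y with clear₁ (y zero) (0≤y zero) | clear-denominators (y ∘ suc) (0≤y ∘ suc)
  where
  clear₁ : ∀ x → 0ℚ ≤ᵠ x → ∃[ d ] ∃[ a ] ι (suc d) *ᵠ x ≡ ι a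
  clear₁ x@(mkℚ (pos a) d _) _ = d , a , ι-clear x a d ℚᵘ.≃-refl
  clear₁ (mkℚ -[1+ _ ] _ _) (*≤* ())
... | d , a , e | D , 0<D , Y , E = suc d * D , *-mono-≤ {1} {suc d} {1} (s≤s z≤n) 0<D ,
  (λ where zero → a * D
           (suc i) → suc d * Y i) ,
  λ where
    zero → trans (cong (_*ᵠ y zero) (ι-* (suc d) D)) (trans (swap (ι (suc d)) (ι D) (y zero))
             (trans (cong (_*ᵠ ι D) e) (sym (ι-* a D))))
    (suc i) → trans (cong (_*ᵠ y (suc i)) (ι-* (suc d) D)) (trans (ℚ.*-assoc (ι (suc d)) (ι D) (y (suc i)))
             (trans (cong (ι (suc d) *ᵠ_) (E i)) (sym (ι-* (suc d) (Y i)))))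
  where
  open ℚ-Solver.+-*-Solver
  swap : ∀ a b c → a *ᵠ b *ᵠ c ≡ a *ᵠ c *ᵠ b
  swap = solve 3 (λ a b c → a :* b :* c := a :* c :* b) refl

-- Finitely many eventual properties hold from a common index on.
eventually-all : {P : Fin n → ℕ → Set} → (∀ i → ∃[ N ] ∀ t → N ≤ t → P i t) →
  ∃[ N ] ∀ t → N ≤ t → ∀ i → P i t
eventually-all {zero}  h = 0 , λ _ _ ()
eventually-all {suc n} h with h zero | eventually-all (h ∘ suc)
... | M , hM | N , hN = M ⊔ N , λ t t≥ → λ where
  zero    → hM t (m⊔n≤o⇒m≤o M N t≥)
  (suc i) → hN t (m⊔n≤o⇒n≤o M N t≥) i

-- From real eigenvectors to natural-number vectors

seq-Σᴿ : (f : Vector ℝ n) → ∀ t → seq (Σᴿ f) t ≡ ∑ᵠ (λ j → seq (f j) t)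
seq-Σᴿ {zero}  f t = refl
seq-Σᴿ {suc n} f t = cong (seq (f zero) t +ᵠ_) (seq-Σᴿ (f ∘ suc) t)

module _ {n : ℕ} (G : Graph n) where
  open Adjacency G

  seq-adjacency : ∀ i j t → seq (adjacency G i j) t ≡ ι (adj i j)
  seq-adjacency i j t with does (Graph._~?_ G i j)
  ... | true  = ι-def 1
  ... | false = ι-def 0

  -- A rational vector that satisfies the eigenvalue equation up to an error η
  -- gives a subeigenvector, once the error is small against one entry.
  approx⇒sub : ∀ r q L (x : Fin n → ℚ) μ η k →
    (∀ i → ∣ ∑ᵠ (λ j → ι (adj i j) *ᵠ x j) -ᵠ μ *ᵠ x i ∣ ≤ᵠ η) →
    ι r ≤ᵠ ι q *ᵠ μ →
    0ℚ <ᵠ ∣ x k ∣ → ι (L * q) *ᵠ η ≤ᵠ ∣ x k ∣ →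
    ApproxSubeigenvector G r q L
  approx⇒sub r q L x μ η k close r≤qμ 0<xₖ small
    with clear-denominators (λ i → ∣ x i ∣) (λ i → ℚ.0≤∣p∣ (x i))
  ... | D , 0<D , Y , E = record
    { vec = Y ; index = k ; positive = Yₖ-positive ; sub = λ i → ι-cancel (sub i) }
    where
    open ℚ.≤-Reasoning
    Yₖ-positive : 0 < Y k
    Yₖ-positive = n≢0⇒n>0 λ Yₖ≡0 → ℚ.<-irrefl refl (ℚ.<-≤-trans
      (ℚ.positive⁻¹ (ι D *ᵠ ∣ x k ∣) {{ℚ.pos*pos⇒pos (ι D) {{ℚ.positive 0<ιD}} ∣ x k ∣ {{ℚ.positive 0<xₖ}}}})
      (ℚ.≤-reflexive (trans (E k) (trans (cong ι Yₖ≡0) ι0≡0))))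
      where
      0<ιD : 0ℚ <ᵠ ι D
      0<ιD = 0<ι 0<D
    -- (A|x|)ᵢ, which bounds |(Ax)ᵢ|.
    S : Fin n → ℚ
    S i = ∑ᵠ (λ j → ι (adj i j) *ᵠ ∣ x j ∣)
    scaled : ∀ i → ι D *ᵠ S i ≡ ι (nbr G Y i)
    scaled i = trans (*-∑ᵠ {n} (ι D) _) (trans (∑ᵠ-cong λ j →
      trans (swap (ι D) (ι (adj i j)) ∣ x j ∣)
        (trans (cong (ι (adj i j) *ᵠ_) (E j)) (sym (ι-* (adj i j) (Y j))))) (∑ᵠ-ι {n} _))
      where
      open ℚ-Solver.+-*-Solver
      swap : ∀ a b c → a *ᵠ (b *ᵠ c) ≡ b *ᵠ (a *ᵠ c)
      swap = solve 3 (λ a b c → a :* (b :* c) := b :* (a :* c)) refl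
    step : ∀ i → ι r *ᵠ ∣ x i ∣ ≤ᵠ ι q *ᵠ (S i +ᵠ η)
    step i = begin
      ι r *ᵠ ∣ x i ∣
        ≤⟨ *ᵠ-monoˡ (ℚ.0≤∣p∣ (x i)) (ℚ.≤-trans r≤qμ (*ᵠ-monoʳ (0≤ι q) (p≤∣p∣ μ))) ⟩
      ι q *ᵠ ∣ μ ∣ *ᵠ ∣ x i ∣
        ≡⟨ ℚ.*-assoc (ι q) ∣ μ ∣ ∣ x i ∣ ⟩
      ι q *ᵠ (∣ μ ∣ *ᵠ ∣ x i ∣)
        ≡⟨ cong (ι q *ᵠ_) (sym (ℚ.∣p*q∣≡∣p∣*∣q∣ μ (x i))) ⟩
      ι q *ᵠ ∣ μ *ᵠ x i ∣
        ≤⟨ *ᵠ-monoʳ (0≤ι q) ∣μx∣≤ ⟩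
      ι q *ᵠ (S i +ᵠ η) ∎
      where
      A : ℚ
      A = ∑ᵠ (λ j → ι (adj i j) *ᵠ x j)
      ∣A∣≤S : ∣ A ∣ ≤ᵠ S i
      ∣A∣≤S = ℚ.≤-trans (∣∑ᵠ∣≤∑ᵠ∣∣ {n} _) (ℚ.≤-reflexive (∑ᵠ-cong λ j →
        trans (ℚ.∣p*q∣≡∣p∣*∣q∣ (ι (adj i j)) (x j)) (cong (_*ᵠ ∣ x j ∣) (ℚ.0≤p⇒∣p∣≡p (0≤ι (adj i j))))))
      ∣μx∣≤ : ∣ μ *ᵠ x i ∣ ≤ᵠ S i +ᵠ η
      ∣μx∣≤ = begin
        ∣ μ *ᵠ x i ∣                         ≡⟨ cong ∣_∣ (split (μ *ᵠ x i) A) ⟩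
        ∣ A -ᵠ (A -ᵠ μ *ᵠ x i) ∣             ≤⟨ ℚ.∣p-q∣≤∣p∣+∣q∣ A (A -ᵠ μ *ᵠ x i) ⟩
        ∣ A ∣ +ᵠ ∣ A -ᵠ μ *ᵠ x i ∣           ≤⟨ ℚ.+-mono-≤ ∣A∣≤S (close i) ⟩
        S i +ᵠ η                             ∎
        where
        open ℚ-Solver.+-*-Solver
        split : ∀ a b → a ≡ b -ᵠ (b -ᵠ a)
        split = solve 2 (λ a b → a := b :- (b :- a)) refl
    sub : ∀ i → ι (L * (r * Y i)) ≤ᵠ ι (L * (q * nbr G Y i) + Y k)
    sub i = begin
      ι (L * (r * Y i))
        ≡⟨ trans (ι-* L _) (cong (ι L *ᵠ_) (trans (ι-* r (Y i)) (cong (ι r *ᵠ_) (sym (E i))))) ⟩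
      ι L *ᵠ (ι r *ᵠ (ι D *ᵠ ∣ x i ∣))
        ≡⟨ e₁ (ι L) (ι r) (ι D) ∣ x i ∣ ⟩
      ι D *ᵠ (ι L *ᵠ (ι r *ᵠ ∣ x i ∣))
        ≤⟨ *ᵠ-monoʳ (0≤ι D) (*ᵠ-monoʳ (0≤ι L) (step i)) ⟩
      ι D *ᵠ (ι L *ᵠ (ι q *ᵠ (S i +ᵠ η)))
        ≡⟨ e₂ (ι D) (ι L) (ι q) (S i) η ⟩
      ι L *ᵠ (ι q *ᵠ (ι D *ᵠ S i)) +ᵠ ι D *ᵠ (ι L *ᵠ ι q *ᵠ η)
        ≤⟨ ℚ.+-monoʳ-≤ (ι L *ᵠ (ι q *ᵠ (ι D *ᵠ S i))) (*ᵠ-monoʳ (0≤ι D)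
             (ℚ.≤-trans (ℚ.≤-reflexive (cong (_*ᵠ η) (sym (ι-* L q)))) small)) ⟩
      ι L *ᵠ (ι q *ᵠ (ι D *ᵠ S i)) +ᵠ ι D *ᵠ ∣ x k ∣
        ≡⟨ cong₂ _+ᵠ_ (trans (cong (λ z → ι L *ᵠ (ι q *ᵠ z)) (scaled i))
             (trans (cong (ι L *ᵠ_) (sym (ι-* q _))) (sym (ι-* L _)))) (E k) ⟩
      ι (L * (q * nbr G Y i)) +ᵠ ι (Y k)
        ≡⟨ sym (ι-+ _ (Y k)) ⟩
      ι (L * (q * nbr G Y i) + Y k) ∎
      where
      open ℚ-Solver.+-*-Solver
      e₁ : ∀ a b c d → a *ᵠ (b *ᵠ (c *ᵠ d)) ≡ c *ᵠ (a *ᵠ (b *ᵠ d))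
      e₁ = solve 4 (λ a b c d → a :* (b :* (c :* d)) := c :* (a :* (b :* d))) refl
      e₂ : ∀ d l q s h → d *ᵠ (l *ᵠ (q *ᵠ (s +ᵠ h))) ≡ l *ᵠ (q *ᵠ (d *ᵠ s)) +ᵠ d *ᵠ (l *ᵠ q *ᵠ h)
      e₂ = solve 5 (λ d l q s h → d :* (l :* (q :* (s :+ h))) := l :* (q :* (d :* s)) :+ d :* (l :* q :* h)) refl

  -- If no subeigenvector existed, then every entry k of the eigenvector would
  -- vanish: a term of its Cauchy sequence that is larger than half of ε keeps
  -- the entry away from 0, and a sufficiently late stage of the eigenvector is
  -- then good enough for approx⇒sub.
  eigenvalue⇒sub : ∀ {μ} r q L → IsEigenvalue (adjacency G) μ →
    (∃[ N ] ∀ t → N ≤ t → ι r ≤ᵠ ι q *ᵠ seq μ t) →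
    ¬ ¬ ApproxSubeigenvector G r q L
  eigenvalue⇒sub {μ} r q L (v , v≉0 , eigen) (Nμ , hμ) none = v≉0 vanish
    where
    open ℚ.≤-Reasoning
    vanish : ∀ k → v k ≈ᴿ 0ᴿ
    vanish k ε 0<ε = case ∣ seq (v k) N ∣ ℚ.≤? half ε of λ where
        (yes small) → N , λ t t≥ → begin
          ∣ seq (v k) t -ᵠ seq 0ᴿ t ∣     ≡⟨ cong ∣_∣ (ℚ.+-identityʳ (seq (v k) t)) ⟩
          ∣ seq (v k) t ∣                 ≤⟨ near (seq (v k) t) (seq (v k) N) (hN t N t≥ ≤-refl) ⟩
          ∣ seq (v k) N ∣ +ᵠ δ            ≤⟨ ℚ.+-mono-≤ small δ≤ ⟩
          half ε +ᵠ half ε                ≡⟨ half+half ε ⟩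
          ε                               ∎
        (no big) → contradiction (subeigenvector (ℚ.<⇒≤ (ℚ.≰⇒> big))) none
      where
      δ : ℚ
      δ = half (half ε)
      0<δ : 0ℚ <ᵠ δ
      0<δ = half-pos (half-pos 0<ε)
      δ≤ : δ ≤ᵠ half ε
      δ≤ = half≤ (half-pos 0<ε)
      N : ℕ
      N = proj₁ (cauchy (v k) δ 0<δ)
      hN = proj₂ (cauchy (v k) δ 0<δ)
      near : ∀ a b → ∣ a -ᵠ b ∣ ≤ᵠ δ → ∣ a ∣ ≤ᵠ ∣ b ∣ +ᵠ δ
      near a b h = begin
        ∣ a ∣                     ≡⟨ cong ∣_∣ (split a b) ⟩
        ∣ b +ᵠ (a -ᵠ b) ∣         ≤⟨ ℚ.∣p+q∣≤∣p∣+∣q∣ b (a -ᵠ b) ⟩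
        ∣ b ∣ +ᵠ ∣ a -ᵠ b ∣       ≤⟨ ℚ.+-monoʳ-≤ ∣ b ∣ h ⟩
        ∣ b ∣ +ᵠ δ                ∎
        where
        open ℚ-Solver.+-*-Solver
        split : ∀ a b → a ≡ b +ᵠ (a -ᵠ b)
        split = solve 2 (λ a b → a := b :+ (a :- b)) refl
      -- The successor makes M invertible.
      M : ℕ
      M = suc (L * q)
      0<ιM : 0ℚ <ᵠ ι M
      0<ιM = 0<ι (s≤s z≤n)
      instance
        ιM-pos : ℚ.Positive (ι M)
        ιM-pos = ℚ.positive 0<ιM
        ιM-nonZero : ℚ.NonZero (ι M)
        ιM-nonZero = ℚ.pos⇒nonZero (ι M)
      η : ℚ
      η = ℚ.1/ ι M *ᵠ δ
      0<η : 0ℚ <ᵠ η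
      0<η = ℚ.positive⁻¹ η {{ℚ.pos*pos⇒pos (ℚ.1/ ι M) {{ℚ.1/pos⇒pos (ι M)}} δ {{ℚ.positive 0<δ}}}}
      Mη≡δ : ι M *ᵠ η ≡ δ
      Mη≡δ = trans (sym (ℚ.*-assoc (ι M) (ℚ.1/ ι M) δ))
        (trans (cong (_*ᵠ δ) (ℚ.*-inverseʳ (ι M))) (ℚ.*-identityˡ δ))
      subeigenvector : half ε ≤ᵠ ∣ seq (v k) N ∣ → ApproxSubeigenvector G r q L
      subeigenvector big = approx⇒sub r q L (λ i → seq (v i) t) (seq μ t) η k close
          (hμ t (≤-trans (m≤n⊔m N Nμ) (m≤m⊔n (N ⊔ Nμ) N′)))
          (ℚ.<-≤-trans 0<δ δ≤vₖ)
          (ℚ.≤-trans (*ᵠ-monoˡ (ℚ.<⇒≤ 0<η) (ι-mono (n≤1+n (L * q)))) (ℚ.≤-trans (ℚ.≤-reflexive Mη≡δ) δ≤vₖ))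
        where
        eventually = eventually-all (λ i → eigen i η 0<η)
        N′ t : ℕ
        N′ = proj₁ eventually
        t = N ⊔ Nμ ⊔ N′
        close : ∀ i → ∣ ∑ᵠ (λ j → ι (adj i j) *ᵠ seq (v j) t) -ᵠ seq μ t *ᵠ seq (v i) t ∣ ≤ᵠ η
        close i = ℚ.≤-trans (ℚ.≤-reflexive (cong (λ z → ∣ z -ᵠ seq μ t *ᵠ seq (v i) t ∣)
            (sym (trans (seq-Σᴿ {n} _ t) (∑ᵠ-cong λ j → cong (_*ᵠ seq (v j) t) (seq-adjacency i j t))))))
          (proj₂ eventually t (m≤n⊔m (N ⊔ Nμ) N′) i)
        δ≤vₖ : δ ≤ᵠ ∣ seq (v k) t ∣
        δ≤vₖ = begin
          δ                                       ≡⟨ cancel δ ⟩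
          δ +ᵠ δ -ᵠ δ                             ≡⟨ cong (_-ᵠ δ) (half+half (half ε)) ⟩
          half ε -ᵠ δ                             ≤⟨ ℚ.+-monoˡ-≤ (ℚ.- δ) (ℚ.≤-trans big
                                                       (near _ _ (hN N t ≤-refl (≤-trans (m≤m⊔n N Nμ) (m≤m⊔n (N ⊔ Nμ) N′))))) ⟩
          ∣ seq (v k) t ∣ +ᵠ δ -ᵠ δ               ≡⟨ cancel′ ∣ seq (v k) t ∣ δ ⟩
          ∣ seq (v k) t ∣                         ∎
          where
          open ℚ-Solver.+-*-Solver
          cancel : ∀ d → d ≡ d +ᵠ d -ᵠ d
          cancel = solve 1 (λ d → d := d :+ d :- d) refl
          cancel′ : ∀ a d → a +ᵠ d -ᵠ d ≡ a
          cancel′ = solve 2 (λ a d → a :+ d :- d := a) refl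

-- Spectral radius, maximal degree and 4-cycles

module _ {n : ℕ} (G : Graph n) where
  open Adjacency G

  -- At the maximum of y, (Ay)ᵢ ≤ Δyᵢ contradicts 2q(Ay)ᵢ ≥ (2(qΔ + 1) − 1)yᵢ.
  sub-degree-bound : ∀ {Δ} → (∀ i → deg i ≤ Δ) → ∀ q → ¬ ApproxSubeigenvector G (suc (q * Δ)) q 2
  sub-degree-bound {Δ} deg≤Δ q y = <⇒≱ {vec w} {2 * vec w}
      (m<m+n (vec w) (≤-trans (≤-trans positive (proj₂ top index)) (m≤m+n (vec w) 0)))
      (+-cancelʳ-≤ (2 * (q * Δ * vec w)) _ _ (begin
        2 * vec w + 2 * (q * Δ * vec w)
          ≡⟨ e (vec w) (q * Δ) ⟩
        2 * (suc (q * Δ) * vec w)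
          ≤⟨ sub w ⟩
        2 * (q * nbr G vec w) + vec index
          ≤⟨ +-mono-≤ (*-monoʳ-≤ 2 (*-monoʳ-≤ q (≤-trans (nbr-≤ G (proj₂ top) w) (*-monoˡ-≤ (vec w) (deg≤Δ w))))) (proj₂ top index) ⟩
        2 * (q * (Δ * vec w)) + vec w
          ≡⟨ e′ (vec w) q Δ ⟩
        vec w + 2 * (q * Δ * vec w) ∎))
    where
    open ApproxSubeigenvector y
    open ≤-Reasoning
    top : ∃[ w ] ∀ i → vec i ≤ vec w
    top = maximum vec index
    w : Fin n
    w = proj₁ top
    e : ∀ v x → 2 * v + 2 * (x * v) ≡ 2 * ((1 + x) * v)
    e = solve-∀
    e′ : ∀ v q Δ → 2 * (q * (Δ * v)) + v ≡ v + 2 * (q * Δ * v)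
    e′ = solve-∀

  eigenvalue≤max-degree : ∀ {Δ} → (∀ i → deg i ≤ Δ) → ∀ ν → IsEigenvalue (adjacency G) ν → ν ≤ᴿ fromℕ Δ
  eigenvalue≤max-degree {Δ} deg≤Δ ν ev ε 0<ε = case seq ν N ℚ.≤? ι Δ +ᵠ half ε of λ where
      (yes small) → N , λ t t≥ → begin
        seq ν t                             ≤⟨ ∣-∣⇒≤ (hN t N t≥ ≤-refl) ⟩
        seq ν N +ᵠ δ                        ≤⟨ ℚ.+-mono-≤ small δ≤ ⟩
        ι Δ +ᵠ half ε +ᵠ half ε             ≡⟨ ℚ.+-assoc (ι Δ) (half ε) (half ε) ⟩
        ι Δ +ᵠ (half ε +ᵠ half ε)           ≡⟨ cong₂ _+ᵠ_ (sym (ι-def Δ)) (half+half ε) ⟩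
        pos Δ ℚ./ 1 +ᵠ ε                      ∎
      (no big) → ⊥-elim (large (ℚ.<⇒≤ (ℚ.≰⇒> big)))
    where
    open ℚ.≤-Reasoning
    δ : ℚ
    δ = half (half ε)
    0<δ : 0ℚ <ᵠ δ
    0<δ = half-pos (half-pos 0<ε)
    δ≤ : δ ≤ᵠ half ε
    δ≤ = half≤ (half-pos 0<ε)
    N : ℕ
    N = proj₁ (cauchy ν δ 0<δ)
    hN = proj₂ (cauchy ν δ 0<δ)
    q : ℕ
    q = proj₁ (archimedes 0<δ)
    large : ι Δ +ᵠ half ε ≤ᵠ seq ν N → ⊥
    large big = eigenvalue⇒sub G {ν} (suc (q * Δ)) q 2 ev (N , lower) (sub-degree-bound deg≤Δ q)
      where
      open ℚ-Solver.+-*-Solver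
      lower : ∀ t → N ≤ t → ι (suc (q * Δ)) ≤ᵠ ι q *ᵠ seq ν t
      lower t t≥ = begin
        ι (1 + q * Δ)                     ≡⟨ trans (ι-+ 1 (q * Δ)) (cong (ι 1 +ᵠ_) (ι-* q Δ)) ⟩
        ι 1 +ᵠ ι q *ᵠ ι Δ                 ≤⟨ ℚ.+-monoˡ-≤ (ι q *ᵠ ι Δ) (proj₂ (archimedes 0<δ)) ⟩
        ι q *ᵠ δ +ᵠ ι q *ᵠ ι Δ            ≡⟨ e (ι q) δ (ι Δ) ⟩
        ι q *ᵠ (ι Δ +ᵠ (δ +ᵠ δ) -ᵠ δ)     ≡⟨ cong (λ z → ι q *ᵠ (ι Δ +ᵠ z -ᵠ δ)) (half+half (half ε)) ⟩
        ι q *ᵠ (ι Δ +ᵠ half ε -ᵠ δ)       ≤⟨ *ᵠ-monoʳ (0≤ι q) (ℚ.+-monoˡ-≤ (ℚ.- δ) (ℚ.≤-trans big (∣-∣⇒≤ (hN N t ≤-refl t≥)))) ⟩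
        ι q *ᵠ (seq ν t +ᵠ δ -ᵠ δ)        ≡⟨ e′ (ι q) (seq ν t) δ ⟩
        ι q *ᵠ seq ν t                    ∎
        where
        e : ∀ q d D → q *ᵠ d +ᵠ q *ᵠ D ≡ q *ᵠ (D +ᵠ (d +ᵠ d) -ᵠ d)
        e = solve 3 (λ q d D → q :* d :+ q :* D := q :* (D :+ (d :+ d) :- d)) refl
        e′ : ∀ q x d → q *ᵠ (x +ᵠ d -ᵠ d) ≡ q *ᵠ x
        e′ = solve 3 (λ q x d → q :* (x :+ d :- d) := q :* x) refl

  -- The rational p/q is the upper approximation of √m at a stage i at which 2/q
  -- is below half of the gap between √m and ρ.
  admissible⇒many-C₄ : ∀ {m} → Admissible m G → size-bound ≤ m → ¬ C₄-factor * #C₄ G ≤ m * m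
  admissible⇒many-C₄ {m} record { size = refl ; ρ = ρ ; isRadius = isRadius ; ρ>√m = ε , 0<ε , Nρ , hρ } large few =
    eigenvalue⇒sub G {ρ} (suc p) q (accuracy G p q) (proj₁ isRadius) (i , lower)
      λ y → many-C₄ G large p q q²m<p² y few
    where
    open ℚ.≤-Reasoning
    δ : ℚ
    δ = half ε
    0<δ : 0ℚ <ᵠ δ
    0<δ = half-pos 0<ε
    M N i q p : ℕ
    M = proj₁ (archimedes (half-pos 0<δ))
    N = proj₁ (cauchy ρ δ 0<δ)
    hN = proj₂ (cauchy ρ δ 0<δ)
    i = M ⊔ N ⊔ Nρ
    q = suc i
    p = suc (isqrt (m * (q * q)))
    q²m<p² : q * q * m < p * p
    q²m<p² = subst (_< p * p) (*-comm m (q * q)) (proj₂ (isqrt-spec (m * (q * q))))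
    1≤qδ/2 : ι 1 ≤ᵠ ι q *ᵠ half δ
    1≤qδ/2 = ℚ.≤-trans (proj₂ (archimedes (half-pos 0<δ)))
      (*ᵠ-monoˡ (ℚ.<⇒≤ (half-pos 0<δ)) (ι-mono (≤-trans (≤-trans (m≤m⊔n M N) (m≤m⊔n (M ⊔ N) Nρ)) (n≤1+n i))))
    lower : ∀ t → i ≤ t → ι (suc p) ≤ᵠ ι q *ᵠ seq ρ t
    lower t t≥ = begin
      ι (2 + isqrt (m * (q * q)))
        ≡⟨ trans (ι-+ 2 _) (cong₂ _+ᵠ_ (ι-+ 1 1) (sym (ι-clear-/ _ i))) ⟩
      ι 1 +ᵠ ι 1 +ᵠ ι q *ᵠ √-approx m i
        ≤⟨ ℚ.+-monoˡ-≤ (ι q *ᵠ √-approx m i) (ℚ.+-mono-≤ 1≤qδ/2 1≤qδ/2) ⟩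
      ι q *ᵠ half δ +ᵠ ι q *ᵠ half δ +ᵠ ι q *ᵠ √-approx m i
        ≡⟨ e (ι q) (half δ) (√-approx m i) ⟩
      ι q *ᵠ (√-approx m i +ᵠ (half δ +ᵠ half δ))
        ≡⟨ cong (λ z → ι q *ᵠ (√-approx m i +ᵠ z)) (half+half δ) ⟩
      ι q *ᵠ (√-approx m i +ᵠ δ)
        ≡⟨ e′ (ι q) (√-approx m i) δ ⟩
      ι q *ᵠ (√-approx m i +ᵠ (δ +ᵠ δ) -ᵠ δ)
        ≡⟨ cong (λ z → ι q *ᵠ (√-approx m i +ᵠ z -ᵠ δ)) (half+half ε) ⟩
      ι q *ᵠ (√-approx m i +ᵠ ε -ᵠ δ)
        ≤⟨ *ᵠ-monoʳ (0≤ι q) (ℚ.+-monoˡ-≤ (ℚ.- δ) (ℚ.≤-trans (hρ i (m≤n⊔m (M ⊔ N) Nρ))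
             (∣-∣⇒≤ (hN i t N≤i (≤-trans N≤i t≥))))) ⟩
      ι q *ᵠ (seq ρ t +ᵠ δ -ᵠ δ)
        ≡⟨ e″ (ι q) (seq ρ t) δ ⟩
      ι q *ᵠ seq ρ t ∎
      where
      N≤i : N ≤ i
      N≤i = ≤-trans (m≤n⊔m M N) (m≤m⊔n (M ⊔ N) Nρ)
      open ℚ-Solver.+-*-Solver
      e : ∀ q d x → q *ᵠ d +ᵠ q *ᵠ d +ᵠ q *ᵠ x ≡ q *ᵠ (x +ᵠ (d +ᵠ d))
      e = solve 3 (λ q d x → q :* d :+ q :* d :+ q :* x := q :* (x :+ (d :+ d))) refl
      e′ : ∀ q x d → q *ᵠ (x +ᵠ d) ≡ q *ᵠ (x +ᵠ (d +ᵠ d) -ᵠ d)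
      e′ = solve 3 (λ q x d → q :* (x :+ d) := q :* (x :+ (d :+ d) :- d)) refl
      e″ : ∀ q x d → q *ᵠ (x +ᵠ d -ᵠ d) ≡ q *ᵠ x
      e″ = solve 3 (λ q x d → q :* (x :+ d :- d) := q :* x) refl

-- Complete graphs with additional disjoint edges

-- The complete graph on n vertices.
complete : ∀ n → Graph n
complete n = record
  { _~_    = _≢_
  ; _~?_   = λ i j → ¬? (i Fin.≟ j)
  ; sym    = λ i≢j j≡i → i≢j (sym j≡i)
  ; irrefl = λ i≡j i≢j → i≢j i≡j
  }

-- The disjoint union of G with a single edge on the new vertices 0 and 1.
addEdge : ∀ {n} → Graph n → Graph (2 + n)
addEdge {n} G = record { _~_ = _~⁺_ ; _~?_ = _~?⁺_ ; sym = λ {i} {j} → sym⁺ i j ; irrefl = λ {i} → irrefl⁺ i }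
  where
  open Graph G renaming (sym to ~-sym)
  _~⁺_ : Fin (2 + n) → Fin (2 + n) → Set
  zero        ~⁺ suc zero    = ⊤
  suc zero    ~⁺ zero        = ⊤
  suc (suc i) ~⁺ suc (suc j) = i ~ j
  _           ~⁺ _           = ⊥
  _~?⁺_ : ∀ i j → Dec (i ~⁺ j)
  zero        ~?⁺ zero        = no λ ()
  zero        ~?⁺ suc zero    = yes tt
  zero        ~?⁺ suc (suc j) = no λ ()
  suc zero    ~?⁺ zero        = yes tt
  suc zero    ~?⁺ suc zero    = no λ ()
  suc zero    ~?⁺ suc (suc j) = no λ ()
  suc (suc i) ~?⁺ zero        = no λ ()
  suc (suc i) ~?⁺ suc zero    = no λ ()
  suc (suc i) ~?⁺ suc (suc j) = i ~? j
  sym⁺ : ∀ i j → i ~⁺ j → j ~⁺ i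
  sym⁺ zero          (suc zero)    _   = tt
  sym⁺ (suc zero)    zero          _   = tt
  sym⁺ (suc (suc i)) (suc (suc j)) i~j = ~-sym i~j
  irrefl⁺ : ∀ i {j} → i ≡ j → ¬ (i ~⁺ j)
  irrefl⁺ (suc (suc i)) refl = irrefl refl

-- The disjoint union of G with r single edges.
addEdges : ∀ {n} r → Graph n → Graph (r * 2 + n)
addEdges zero    G = G
addEdges (suc r) G = addEdge (addEdges r G)

∑-suc² : ∀ {n} (f : Fin (2 + n) → ℕ) → ∑ f ≡ f zero + (f (suc zero) + (∑[ i ] f (suc (suc i))))
∑-suc² f = trans (∑-suc f) (cong (f zero +_) (∑-suc _))

module _ {n : ℕ} (G : Graph n) where
  open Adjacency

  nbr-addEdge-new₀ : ∀ w → nbr (addEdge G) w zero ≡ w (suc zero)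
  nbr-addEdge-new₀ w = trans (∑-suc² _) (trans
    (cong₂ _+_ (*-identityˡ (w (suc zero))) (trans (∑-const n 0) (*-zeroʳ n))) (+-identityʳ _))

  nbr-addEdge-new₁ : ∀ w → nbr (addEdge G) w (suc zero) ≡ w zero
  nbr-addEdge-new₁ w = trans (∑-suc² _) (trans
    (cong₂ _+_ (*-identityˡ (w zero)) (trans (∑-const n 0) (*-zeroʳ n))) (+-identityʳ _))

  nbr-addEdge-old : ∀ w i → nbr (addEdge G) w (suc (suc i)) ≡ nbr G (λ j → w (suc (suc j))) i
  nbr-addEdge-old w i = ∑-suc² _

deg≡nbr : ∀ {n} (G : Graph n) i → Adjacency.deg G i ≡ nbr G (λ _ → 1) i
deg≡nbr G i = ∑-cong λ j → sym (*-identityʳ _)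

#edges-addEdge : ∀ {n} (G : Graph n) → #edges (addEdge G) ≡ suc (#edges G)
#edges-addEdge G = *-cancelˡ-≡ _ _ 2 (begin
  2 * #edges (addEdge G)
    ≡⟨ Adjacency.handshake (addEdge G) ⟨
  ∑ (Adjacency.deg (addEdge G))
    ≡⟨ ∑-suc² _ ⟩
  Adjacency.deg (addEdge G) zero + (Adjacency.deg (addEdge G) (suc zero) + (∑[ i ] Adjacency.deg (addEdge G) (suc (suc i))))
    ≡⟨ cong₂ _+_ (trans (deg≡nbr (addEdge G) zero) (nbr-addEdge-new₀ G (λ _ → 1)))
         (cong₂ _+_ (trans (deg≡nbr (addEdge G) (suc zero)) (nbr-addEdge-new₁ G (λ _ → 1)))
           (∑-cong λ i → ∑-suc² _)) ⟩
  2 + ∑ (Adjacency.deg G)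
    ≡⟨ cong (2 +_) (Adjacency.handshake G) ⟩
  2 + 2 * #edges G
    ≡⟨ e (#edges G) ⟩
  2 * suc (#edges G) ∎)
  where
  open ≡-Reasoning
  e : ∀ m → 2 + 2 * m ≡ 2 * (1 + m)
  e = solve-∀

#edges-addEdges : ∀ {n} r (G : Graph n) → #edges (addEdges r G) ≡ r + #edges G
#edges-addEdges zero    G = refl
#edges-addEdges (suc r) G = trans (#edges-addEdge (addEdges r G)) (cong suc (#edges-addEdges r G))

deg-complete : ∀ k i → Adjacency.deg (complete (suc k)) i ≡ k
deg-complete k i = suc-injective (begin
  1 + deg i                                ≡⟨ cong (_+ deg i) (∑-eq-1 i) ⟨
  (∑[ j ] eq i j) + deg i                  ≡⟨ ∑-+ _ _ ⟨
  (∑[ j ] (eq i j + adj i j))              ≡⟨ ∑-cong (λ j → one (i Fin.≟ j)) ⟩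
  (∑[ j ] 1)                               ≡⟨ trans (∑-const (suc k) 1) (*-identityʳ (suc k)) ⟩
  suc k                                    ∎)
  where
  open ≡-Reasoning
  open Adjacency (complete (suc k))
  one : ∀ {P : Set} (d : Dec P) → 𝟙 d + 𝟙 (¬? d) ≡ 1
  one (yes _) = refl
  one (no  _) = refl
  ∑-eq-1 : ∀ i → (∑[ j ] eq i j) ≡ 1
  ∑-eq-1 i = trans (∑-cong λ j → sym (*-identityʳ (eq i j))) (∑-eq (λ _ → 1) i)

-- The maximal degree is at most Δ, and Δ is an eigenvalue.  The eigenvector
-- has natural entries, one of which is 1.
record HasDegreeEigenvalue {n} (G : Graph n) (Δ : ℕ) : Set where
  field
    deg≤   : ∀ i → Adjacency.deg G i ≤ Δ
    vec    : Fin n → ℕ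
    index  : Fin n
    vec≡1  : vec index ≡ 1
    eigen  : ∀ i → nbr G vec i ≡ Δ * vec i

complete-eigenvalue : ∀ k → HasDegreeEigenvalue (complete (suc k)) k
complete-eigenvalue k = record
  { deg≤  = λ i → ≤-reflexive (deg-complete k i)
  ; vec   = λ _ → 1
  ; index = zero
  ; vec≡1 = refl
  ; eigen = λ i → trans (sym (deg≡nbr (complete (suc k)) i)) (trans (deg-complete k i) (sym (*-identityʳ k)))
  }

addEdges-eigenvalue : ∀ {n} {G : Graph n} {Δ} → 0 < Δ → ∀ r →
  HasDegreeEigenvalue G Δ → HasDegreeEigenvalue (addEdges r G) Δ
addEdges-eigenvalue 0<Δ zero    h = h
addEdges-eigenvalue {G = G} {Δ} 0<Δ (suc r) h = record
  { deg≤  = λ where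
      zero          → ≤-trans (≤-reflexive (trans (deg≡nbr H⁺ zero) (nbr-addEdge-new₀ H (λ _ → 1)))) 0<Δ
      (suc zero)    → ≤-trans (≤-reflexive (trans (deg≡nbr H⁺ (suc zero)) (nbr-addEdge-new₁ H (λ _ → 1)))) 0<Δ
      (suc (suc i)) → ≤-trans (≤-reflexive (∑-suc² _)) (deg≤ i)
  ; vec   = w
  ; index = suc (suc index)
  ; vec≡1 = vec≡1
  ; eigen = λ where
      zero          → trans (nbr-addEdge-new₀ H w) (sym (*-zeroʳ Δ))
      (suc zero)    → trans (nbr-addEdge-new₁ H w) (sym (*-zeroʳ Δ))
      (suc (suc i)) → trans (nbr-addEdge-old H w i) (eigen i)
  }
  where
  H = addEdges r G
  H⁺ = addEdge H
  open HasDegreeEigenvalue (addEdges-eigenvalue 0<Δ r h)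
  w : Fin _ → ℕ
  w zero          = 0
  w (suc zero)    = 0
  w (suc (suc i)) = vec i

degree-eigenvalue⇒radius : ∀ {n} (G : Graph n) {Δ} → HasDegreeEigenvalue G Δ → IsSpectralRadius G (fromℕ Δ)
degree-eigenvalue⇒radius {n} G {Δ} h =
  ((λ i → fromℕ (vec i)) , nonzero , eigenvector) , eigenvalue≤max-degree G deg≤
  where
  open HasDegreeEigenvalue h
  open Adjacency G
  nonzero : ¬ (∀ i → fromℕ (vec i) ≈ᴿ 0ᴿ)
  nonzero v≈0 with v≈0 index ½ (ℚ.positive⁻¹ ½)
  ... | N , small = from-no (∣ pos 1 ℚ./ 1 -ᵠ pos 0 ℚ./ 1 ∣ ℚ.≤? ½)
    (subst (λ x → ∣ pos x ℚ./ 1 -ᵠ pos 0 ℚ./ 1 ∣ ≤ᵠ ½) vec≡1 (small N ≤-refl))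
  eigenvector : ∀ i → Σᴿ (λ j → adjacency G i j *ᴿ fromℕ (vec j)) ≈ᴿ fromℕ Δ *ᴿ fromℕ (vec i)
  eigenvector i ε 0<ε = 0 , λ t _ → ℚ.≤-trans (ℚ.≤-reflexive (cong ∣_∣ (trans
      (cong (_-ᵠ ((pos Δ ℚ./ 1) *ᵠ (pos (vec i) ℚ./ 1))) (Av≡Δv t))
      (ℚ.+-inverseʳ ((pos Δ ℚ./ 1) *ᵠ (pos (vec i) ℚ./ 1)))))) (ℚ.<⇒≤ 0<ε)
    where
    Av≡Δv : ∀ t → seq (Σᴿ (λ j → adjacency G i j *ᴿ fromℕ (vec j))) t ≡ (pos Δ ℚ./ 1) *ᵠ (pos (vec i) ℚ./ 1)
    Av≡Δv t = begin
      seq (Σᴿ (λ j → adjacency G i j *ᴿ fromℕ (vec j))) t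
        ≡⟨ seq-Σᴿ {n} _ t ⟩
      ∑ᵠ (λ j → seq (adjacency G i j) t *ᵠ (pos (vec j) ℚ./ 1))
        ≡⟨ ∑ᵠ-cong (λ j → trans (cong₂ _*ᵠ_ (seq-adjacency G i j t) (ι-def (vec j))) (sym (ι-* (adj i j) (vec j)))) ⟩
      ∑ᵠ {n} (λ j → ι (adj i j * vec j))
        ≡⟨ ∑ᵠ-ι {n} (λ j → adj i j * vec j) ⟩
      ι (nbr G vec i)
        ≡⟨ trans (cong ι (eigen i)) (ι-* Δ (vec i)) ⟩
      ι Δ *ᵠ ι (vec i)
        ≡⟨ sym (cong₂ _*ᵠ_ (ι-def Δ) (ι-def (vec i))) ⟩
      (pos Δ ℚ./ 1) *ᵠ (pos (vec i) ℚ./ 1) ∎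
      where open ≡-Reasoning

-- I² + s² ≤ k²I² with s = kI - d gives I² ≤ 2dkI.
below-square : ∀ k I s .{{_ : NonZero I}} → I * I + s * s ≤ k * k * (I * I) →
  2 * k * s + I * 1 ≤ I * (2 * k * k)
below-square k I s h = begin
  2 * k * s + I * 1             ≤⟨ +-monoʳ-≤ (2 * k * s) I≤2kd ⟩
  2 * k * s + 2 * k * d         ≡⟨ *-distribˡ-+ (2 * k) s d ⟨
  2 * k * (s + d)               ≡⟨ cong (2 * k *_) s+d≡kI ⟩
  2 * k * (k * I)               ≡⟨ e₁ k I ⟩
  I * (2 * k * k)               ∎
  where
  open ≤-Reasoning
  h′ : I * I + s * s ≤ k * I * (k * I)
  h′ = ≤-trans h (≤-reflexive (e k I))
    where
    e : ∀ k I → k * k * (I * I) ≡ k * I * (k * I)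
    e = solve-∀
  d : ℕ
  d = k * I ∸ s
  s+d≡kI : s + d ≡ k * I
  s+d≡kI = m+[n∸m]≡n (sq-cancel-≤ {s} (≤-trans (m≤n+m (s * s) (I * I)) h′))
  e₁ : ∀ k I → 2 * k * (k * I) ≡ I * (2 * k * k)
  e₁ = solve-∀
  e₂ : ∀ s d → (s + d) * (s + d) + d * d ≡ 2 * d * (s + d) + s * s
  e₂ = solve-∀
  e₃ : ∀ d k I → 2 * d * (k * I) ≡ 2 * k * d * I
  e₃ = solve-∀
  I≤2kd : I * 1 ≤ 2 * k * d
  I≤2kd = ≤-trans (≤-reflexive (*-identityʳ I)) (*-cancelʳ-≤ I (2 * k * d) I (+-cancelʳ-≤ (s * s) _ _ (begin
    I * I + s * s                 ≤⟨ h′ ⟩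
    k * I * (k * I)               ≡⟨ cong₂ _*_ s+d≡kI s+d≡kI ⟨
    (s + d) * (s + d)             ≤⟨ m≤m+n _ (d * d) ⟩
    (s + d) * (s + d) + d * d     ≡⟨ e₂ s d ⟩
    2 * d * (s + d) + s * s       ≡⟨ cong (λ x → 2 * d * x + s * s) s+d≡kI ⟩
    2 * d * (k * I) + s * s       ≡⟨ cong (_+ s * s) (e₃ d k I) ⟩
    2 * k * d * I + s * s         ∎)))

-- The gap between √m and k is at least 1/2k when m < k², which is the witness
-- for the strict inequality.
√m<k : ∀ m k → m < k * k → √ m <ᴿ fromℕ k
√m<k m zero    ()
√m<k m k@(suc k′) m<k² = ε , 0<ε , 0 , λ t _ →
  subst (λ z → √-approx m t +ᵠ ε ≤ᵠ z) (sym (ι-def k)) (bound t)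
  where
  instance
    ι-pos : ∀ {x} → ℚ.Positive (ι (suc x))
    ι-pos {x} = ℚ.positive (0<ι (s≤s (z≤n {x})))
  ε : ℚ
  ε = pos 1 ℚ./ (2 * k)
  0<ε : 0ℚ <ᵠ ε
  0<ε = ℚ.*-cancelˡ-<-nonNeg (ι (2 * k)) {{ℚ.pos⇒nonNeg (ι (2 * k))}} (ℚ.<-≤-trans
    (ℚ.≤-<-trans (ℚ.≤-reflexive (ℚ.*-zeroʳ (ι (2 * k)))) (ℚ.positive⁻¹ 1ℚ))
    (ℚ.≤-reflexive (sym (trans (ι-clear-/ 1 (k′ + (k + 0))) ι1≡1))))
  bound : ∀ t → √-approx m t +ᵠ ε ≤ᵠ ι k
  bound t = ℚ.*-cancelˡ-≤-pos (ι (2 * k)) (ℚ.*-cancelˡ-≤-pos (ι I) (begin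
    ι I *ᵠ (ι (2 * k) *ᵠ (√-approx m t +ᵠ ε))
      ≡⟨ e (ι I) (ι (2 * k)) (√-approx m t) ε ⟩
    ι (2 * k) *ᵠ (ι I *ᵠ √-approx m t) +ᵠ ι I *ᵠ (ι (2 * k) *ᵠ ε)
      ≡⟨ cong₂ (λ x y → ι (2 * k) *ᵠ x +ᵠ ι I *ᵠ y) (ι-clear-/ s t) (ι-clear-/ 1 (k′ + (k + 0))) ⟩
    ι (2 * k) *ᵠ ι s +ᵠ ι I *ᵠ ι 1
      ≡⟨ sym (trans (ι-+ (2 * k * s) (I * 1)) (cong₂ _+ᵠ_ (ι-* (2 * k) s) (ι-* I 1))) ⟩
    ι (2 * k * s + I * 1)
      ≤⟨ ι-mono natural ⟩
    ι (I * (2 * k * k))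
      ≡⟨ trans (ι-* I (2 * k * k)) (cong (ι I *ᵠ_) (ι-* (2 * k) k)) ⟩
    ι I *ᵠ (ι (2 * k) *ᵠ ι k) ∎))
    where
    open ℚ.≤-Reasoning
    I s : ℕ
    I = suc t
    s = isqrt (m * (I * I))
    e : ∀ a b x y → a *ᵠ (b *ᵠ (x +ᵠ y)) ≡ b *ᵠ (a *ᵠ x) +ᵠ a *ᵠ (b *ᵠ y)
    e = solve 4 (λ a b x y → a :* (b :* (x :+ y)) := b :* (a :* x) :+ a :* (b :* y)) refl
      where open ℚ-Solver.+-*-Solver
    natural : 2 * k * s + I * 1 ≤ I * (2 * k * k)
    natural = below-square k I s (≤-trans
      (+-monoʳ-≤ (I * I) (proj₁ (isqrt-spec (m * (I * I)))))
      (*-monoˡ-≤ (I * I) m<k²))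

-- Existence of admissible graphs

-- The number of edges of the complete graph on k + 1 vertices.
triangular : ℕ → ℕ
triangular zero    = 0
triangular (suc k) = suc k + triangular k

2*triangular : ∀ k → 2 * triangular k ≡ suc k * k
2*triangular zero    = refl
2*triangular (suc k) = trans (*-distribˡ-+ 2 (suc k) (triangular k))
  (trans (cong (2 * suc k +_) (2*triangular k)) (e k))
  where
  e : ∀ k → 2 * (1 + k) + (1 + k) * k ≡ (2 + k) * (1 + k)
  e = solve-∀

#edges-complete : ∀ k → #edges (complete (suc k)) ≡ triangular k
#edges-complete k = *-cancelˡ-≡ _ _ 2 (begin
  2 * #edges (complete (suc k))                 ≡⟨ Adjacency.handshake (complete (suc k)) ⟨
  ∑ (Adjacency.deg (complete (suc k)))          ≡⟨ ∑-cong (deg-complete k) ⟩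
  ∑ {suc k} (λ _ → k)                           ≡⟨ ∑-const (suc k) k ⟩
  suc k * k                                     ≡⟨ 2*triangular k ⟨
  2 * triangular k                              ∎)
  where open ≡-Reasoning

triangular-root : ∀ j → ∃[ k ] ∃[ r ] 4 ≤ k × r ≤ k × 10 + j ≡ triangular k + r
triangular-root zero = 4 , 0 , ≤-refl , z≤n , refl
triangular-root (suc j) with triangular-root j
... | k , r , 4≤k , r≤k , e with r <? k
... | yes r<k = k , suc r , 4≤k , r<k , trans (cong suc e) (sym (+-suc (triangular k) r))
... | no  r≮k = suc k , 0 , m≤n⇒m≤1+n 4≤k , z≤n , trans (cong suc e)
  (trans (cong (λ x → suc (triangular k + x)) (≤-antisym r≤k (≮⇒≥ r≮k)))
    (trans (cong suc (+-comm (triangular k) k)) (sym (+-identityʳ _))))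

-- k² exceeds triangular k + k from k = 4 on.
triangular<square : ∀ k → 4 ≤ k → triangular k + k < k * k
triangular<square k 4≤k = *-cancelˡ-< 2 _ _ (begin-strict
  2 * (triangular k + k)          ≡⟨ *-distribˡ-+ 2 (triangular k) k ⟩
  2 * triangular k + 2 * k        ≡⟨ cong (_+ 2 * k) (2*triangular k) ⟩
  suc k * k + 2 * k               ≡⟨ e₁ k ⟩
  k * k + 3 * k                   <⟨ +-monoʳ-< (k * k) (*-monoˡ-< k {{>-nonZero (≤-trans (s≤s z≤n) 4≤k)}} 4≤k) ⟩
  k * k + k * k                   ≡⟨ cong (k * k +_) (sym (+-identityʳ (k * k))) ⟩
  2 * (k * k)                     ∎)
  where
  open ≤-Reasoning
  e₁ : ∀ k → (1 + k) * k + 2 * k ≡ k * k + 3 * k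
  e₁ = solve-∀

-- A complete graph on k + 1 vertices together with r ≤ k disjoint edges has
-- spectral radius k.
admissible-exists : ∀ m → 10 ≤ m → ∃[ n ] Σ[ G ∈ Graph n ] Admissible m G
admissible-exists m 10≤m with triangular-root (m ∸ 10)
... | k , r , 4≤k , r≤k , e = _ , addEdges r (complete (suc k)) , record
  { size     = trans (#edges-addEdges r _) (trans (cong (r +_) (#edges-complete k)) (trans (+-comm r _) (sym m≡)))
  ; ρ        = fromℕ k
  ; isRadius = degree-eigenvalue⇒radius _
      (addEdges-eigenvalue (≤-trans (s≤s z≤n) 4≤k) r (complete-eigenvalue k))
  ; ρ>√m     = √m<k m k (subst (_< k * k) (sym m≡)
      (≤-<-trans (+-monoʳ-≤ (triangular k) r≤k) (triangular<square k 4≤k)))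
  }
  where
  m≡ : m ≡ triangular k + r
  m≡ = trans (sym (m+[n∸m]≡n 10≤m)) e

-- The order of magnitude of the minimal number of 4-cycles

m²≤C₄-factor*#C₄ : ∀ {m n} (G : Graph n) → Admissible m G → size-bound ≤ m →
  m * m ≤ C₄-factor * #C₄ G
m²≤C₄-factor*#C₄ {m} G adm large with m * m ≤? C₄-factor * #C₄ G
... | yes many = many
... | no  few  = contradiction (<⇒≤ (≰⇒> few)) (admissible⇒many-C₄ G adm large)

#C₄≤2m² : ∀ {m n} (G : Graph n) → Admissible m G → #C₄ G ≤ 2 * (m * m)
#C₄≤2m² G record { size = refl } = Adjacency.#C₄≤2m² G

m^2≡m*m : ∀ m → m ^ 2 ≡ m * m
m^2≡m*m m = cong (m *_) (*-identityʳ m)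

mainTheorem2 : Σ[ c ∈ ℝ ] Σ[ C ∈ ℝ ] Σ[ m₀ ∈ ℕ ]
    0ᴿ <ᴿ c × 0ᴿ <ᴿ C ×
    (∀ m → m₀ ≤ m →
    (∃[ n ] Σ[ G ∈ Graph n ] Admissible m G) ×
    (∀ k → k isMinC₄For m →
    c *ᴿ fromℕ (m ^ 2) ≤ᴿ fromℕ k ×
    fromℕ k ≤ᴿ C *ᴿ fromℕ (m ^ 2)))
-- The lower constant is 1/N, where the successor in N only serves to make N
-- visibly nonzero.
mainTheorem2 = fromℚ c , fromℕ 2 , size-bound , 0<c , 0<2 , λ m large →
    admissible-exists m (≤-trans (m≤m+n 10 246) (≤-trans 256≤size-bound large)) ,
    λ where
      k ((_ , G , adm , refl) , _) →
        lower m k (m²≤C₄-factor*#C₄ G adm large) , upper m k (#C₄≤2m² G adm)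
  where
  open ℚ.≤-Reasoning
  N : ℕ
  N = suc C₄-factor
  instance
    ιN-pos : ℚ.Positive (ι N)
    ιN-pos = ℚ.positive (0<ι (s≤s z≤n))
    ιN-nonZero : ℚ.NonZero (ι N)
    ιN-nonZero = ℚ.pos⇒nonZero (ι N)
  c : ℚ
  c = ℚ.1/ ι N
  c-pos : 0ℚ <ᵠ c
  c-pos = ℚ.positive⁻¹ c {{ℚ.1/pos⇒pos (ι N)}}
  0<c : 0ᴿ <ᴿ fromℚ c
  0<c = c , c-pos , 0 , λ _ _ → ℚ.≤-reflexive (ℚ.+-identityˡ c)
  0<2 : 0ᴿ <ᴿ fromℕ 2
  0<2 = 1ℚ , ℚ.positive⁻¹ 1ℚ , 0 , λ _ _ → from-yes (0ℚ +ᵠ 1ℚ ℚ.≤? pos 2 ℚ./ 1)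
  p≤p+ε : ∀ p {ε} → 0ℚ <ᵠ ε → p ≤ᵠ p +ᵠ ε
  p≤p+ε p 0<ε = ℚ.≤-trans (ℚ.≤-reflexive (sym (ℚ.+-identityʳ p))) (ℚ.+-monoʳ-≤ p (ℚ.<⇒≤ 0<ε))
  lower : ∀ m k → m * m ≤ C₄-factor * k → fromℚ c *ᴿ fromℕ (m ^ 2) ≤ᴿ fromℕ k
  lower m k m²≤ ε 0<ε = 0 , λ _ _ → begin
    c *ᵠ (pos (m ^ 2) ℚ./ 1)     ≡⟨ cong (c *ᵠ_) (trans (ι-def (m ^ 2)) (cong ι (m^2≡m*m m))) ⟩
    c *ᵠ ι (m * m)               ≤⟨ *ᵠ-monoʳ (ℚ.<⇒≤ c-pos) (ι-mono (≤-trans m²≤ (m≤n+m (C₄-factor * k) k))) ⟩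
    c *ᵠ ι (N * k)               ≡⟨ cong (c *ᵠ_) (ι-* N k) ⟩
    c *ᵠ (ι N *ᵠ ι k)            ≡⟨ ℚ.*-assoc c (ι N) (ι k) ⟨
    c *ᵠ ι N *ᵠ ι k              ≡⟨ cong (_*ᵠ ι k) (ℚ.*-inverseˡ (ι N)) ⟩
    1ℚ *ᵠ ι k                    ≡⟨ ℚ.*-identityˡ (ι k) ⟩
    ι k                          ≡⟨ ι-def k ⟨
    pos k ℚ./ 1                  ≤⟨ p≤p+ε _ 0<ε ⟩
    pos k ℚ./ 1 +ᵠ ε             ∎
  upper : ∀ m k → k ≤ 2 * (m * m) → fromℕ k ≤ᴿ fromℕ 2 *ᴿ fromℕ (m ^ 2)
  upper m k k≤ ε 0<ε = 0 , λ _ _ → begin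
    pos k ℚ./ 1                                  ≡⟨ ι-def k ⟩
    ι k                                          ≤⟨ ι-mono k≤ ⟩
    ι (2 * (m * m))                              ≡⟨ trans (ι-* 2 (m * m)) (cong (λ x → ι 2 *ᵠ ι x) (sym (m^2≡m*m m))) ⟩
    ι 2 *ᵠ ι (m ^ 2)                             ≡⟨ cong₂ _*ᵠ_ (ι-def 2) (ι-def (m ^ 2)) ⟨
    (pos 2 ℚ./ 1) *ᵠ (pos (m ^ 2) ℚ./ 1)         ≤⟨ p≤p+ε _ 0<ε ⟩
    (pos 2 ℚ./ 1) *ᵠ (pos (m ^ 2) ℚ./ 1) +ᵠ ε    ∎
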